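{- Let $d\in\mathbb{N}$. For each $s\in\mathbb{N}$, let $\chi_d(s)$ be the number of points $(m,n)\in\mathbb{Z}^2$ for which the conditions $$(m,n)=\sum_{k=1}^s\big(f(-i_k),\,f(-i_k-1)\big)\quad\text{and}\quad \sum_{k=1}^s f(i_k)\le d$$ admit a solution in integers $0\le i_1\le\dots\le i_s$, and $s$ is maximal with this property (i.e. no solution exists with a larger number of terms). Then $$\chi_d(s)=\begin{cases}2s+1 & \text{if } 0\le s<d,\\ d+1 & \text{if } s=d,\\ 0 & \text{if } s>d.\end{cases}$$ Equivalently: for every $s\in\mathbb{N}$, the set $E_d(s)=\{\alpha\in E_d:\ s_d(\alpha)=s\}$ is empty for $s>d$, has $2s+1$ elements for $0\le s<d$, and has $d+1$ elements for $s=d$.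
   Context: $\mathbb{N}=\{0,1,2,\dots\}$. Let $f\colon\mathbb{Z}\to\mathbb{Z}$ be defined by $f(0)=f(1)=1$ and $f(i+2)=f(i+1)+f(i)$ for all $i\in\mathbb{Z}$ (so $(f(i))_{i\ge0}$ is the Fibonacci sequence, and e.g. $f(-1)=0$, $f(-2)=1$). An empty sum is $0$ (so $(m,n)=(0,0)$ satisfies the conditions with $s=0$). Let $\gamma=(1+\sqrt5)/2$ and $\mathbb{Z}[\gamma]=\mathbb{Z}\oplus\mathbb{Z}\gamma^{ -1}$; one has $\gamma^{ -i}=f(-i)+f(-i-1)\gamma^{ -1}$ for $i\in\mathbb{Z}$. For $d\in\mathbb{N}$, $E_d$ denotes the set of $\alpha\in\mathbb{Z}[\gamma]$ such that $\alpha=\gamma^{ -i_1}+\dots+\gamma^{ -i_s}$ and $f(i_1)+\dots+f(i_s)\le d$ for some $s\in\mathbb{N}$ and integers $0\le i_1\le\dots\le i_s$; for $\alpha\in E_d$, $s_d(\alpha)$ is the largest such $s$. -}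

module Defs where

open import Algebra.Bundles using (CommutativeRing; RawMonoid; Semiring)
import Algebra.Construct.DirectProduct as DirectProduct
import Algebra.Definitions.RawSemiring as RawSemiringDefinitions
open import Data.Integer.Base using (ℤ; +_; -[1+_]; -_; _+_; _-_; _*_; _≤_; +-0-rawMonoid)
import Data.Integer.Properties as ℤ
open import Data.Integer.Tactic.RingSolver using (solve-∀)
open import Data.List.Base using (List; length)
open import Data.List.Membership.Propositional using (_∈_)
open import Data.List.Relation.Unary.Unique.Propositional using (Unique)
import Data.Nat.Base as ℕ
open import Data.Nat.Base using (ℕ; zero; suc)
import Data.Nat.Properties as ℕ
open import Data.Product.Base using (_×_; _,_; ∃-syntax)
open import Data.Vec.Base using (Vec; map; foldr′)
open import Data.Vec.Relation.Unary.Linked using (Linked)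
open import Function.Bundles using (_⇔_)
open import Level using (0ℓ)
open import Relation.Binary.PropositionalEquality
  using (_≡_; refl; cong; cong₂; isEquivalence)
open import Relation.Unary using (Pred)

f : ℤ → ℤ
f (+ zero)            = + 1
f (+ suc zero)        = + 1
f (+ suc (suc n))     = f (+ suc n) + f (+ n)
f -[1+ zero ]         = + 0
f -[1+ suc zero ]     = + 1
f -[1+ suc (suc n) ]  = f -[1+ n ] - f -[1+ suc n ]

f-rec : ∀ i → f (i + + 2) ≡ f (i + + 1) + f i
f-rec (+ n) rewrite ℕ.+-comm n 2 | ℕ.+-comm n 1 = refl
f-rec -[1+ zero ]          = refl
f-rec -[1+ suc zero ]      = refl
f-rec -[1+ suc (suc n) ]   = lemma (f -[1+ n ]) (f -[1+ suc n ])
  where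
  lemma : ∀ a b → a ≡ b + (a - b)
  lemma = solve-∀

-- a ⊕ b γ⁻¹, the elements of ℤ[γ] in the ℤ-basis 1, γ⁻¹.
infix 5 _⊕_γ⁻¹
record ℤ[γ] : Set where
  constructor _⊕_γ⁻¹
  field
    coeff₀ coeff₁ : ℤ

infixl 6 _+ᵧ_
infixl 7 _*ᵧ_

_+ᵧ_ : ℤ[γ] → ℤ[γ] → ℤ[γ]
(a ⊕ b γ⁻¹) +ᵧ (c ⊕ d γ⁻¹) = (a + c) ⊕ (b + d) γ⁻¹

-- Since γ² = γ + 1, we have (γ⁻¹)² = 1 - γ⁻¹.
_*ᵧ_ : ℤ[γ] → ℤ[γ] → ℤ[γ]
(a ⊕ b γ⁻¹) *ᵧ (c ⊕ d γ⁻¹) = (a * c + b * d) ⊕ (a * d + b * c - b * d) γ⁻¹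

-ᵧ_ : ℤ[γ] → ℤ[γ]
-ᵧ (a ⊕ b γ⁻¹) = (- a) ⊕ (- b) γ⁻¹

0ᵧ 1ᵧ γ γ⁻¹ : ℤ[γ]
0ᵧ  = + 0 ⊕ + 0 γ⁻¹
1ᵧ  = + 1 ⊕ + 0 γ⁻¹
γ   = + 1 ⊕ + 1 γ⁻¹
γ⁻¹ = + 0 ⊕ + 1 γ⁻¹

γ-square : γ *ᵧ γ ≡ γ +ᵧ 1ᵧ
γ-square = refl

γ-inverse : γ *ᵧ γ⁻¹ ≡ 1ᵧ
γ-inverse = refl

ℤ[γ]-commutativeRing : CommutativeRing 0ℓ 0ℓ
ℤ[γ]-commutativeRing = record
  { Carrier = ℤ[γ]
  ; _≈_ = _≡_
  ; _+_ = _+ᵧ_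
  ; _*_ = _*ᵧ_
  ; -_  = -ᵧ_
  ; 0#  = 0ᵧ
  ; 1#  = 1ᵧ
  ; isCommutativeRing = record
    { isRing = record
      { +-isAbelianGroup = record
        { isGroup = record
          { isMonoid = record
            { isSemigroup = record
              { isMagma = record { isEquivalence = isEquivalence ; ∙-cong = cong₂ _+ᵧ_ }
              ; assoc = λ (a ⊕ b γ⁻¹) (c ⊕ d γ⁻¹) (e ⊕ g γ⁻¹) →
                  cong₂ _⊕_γ⁻¹ (ℤ.+-assoc a c e) (ℤ.+-assoc b d g)
              }
            ; identity =
                (λ (a ⊕ b γ⁻¹) → cong₂ _⊕_γ⁻¹ (ℤ.+-identityˡ a) (ℤ.+-identityˡ b))
              , (λ (a ⊕ b γ⁻¹) → cong₂ _⊕_γ⁻¹ (ℤ.+-identityʳ a) (ℤ.+-identityʳ b))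
            }
          ; inverse =
              (λ (a ⊕ b γ⁻¹) → cong₂ _⊕_γ⁻¹ (ℤ.+-inverseˡ a) (ℤ.+-inverseˡ b))
            , (λ (a ⊕ b γ⁻¹) → cong₂ _⊕_γ⁻¹ (ℤ.+-inverseʳ a) (ℤ.+-inverseʳ b))
          ; ⁻¹-cong = cong -ᵧ_
          }
        ; comm = λ (a ⊕ b γ⁻¹) (c ⊕ d γ⁻¹) →
            cong₂ _⊕_γ⁻¹ (ℤ.+-comm a c) (ℤ.+-comm b d)
        }
      ; *-cong = cong₂ _*ᵧ_
      ; *-assoc = λ (a ⊕ b γ⁻¹) (c ⊕ d γ⁻¹) (e ⊕ g γ⁻¹) →
          cong₂ _⊕_γ⁻¹ (assoc₀ a b c d e g) (assoc₁ a b c d e g)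
      ; *-identity =
            (λ (a ⊕ b γ⁻¹) → cong₂ _⊕_γ⁻¹ (idˡ₀ a b) (idˡ₁ a b))
          , (λ (a ⊕ b γ⁻¹) → cong₂ _⊕_γ⁻¹ (idʳ₀ a b) (idʳ₁ a b))
      ; distrib =
            (λ (a ⊕ b γ⁻¹) (c ⊕ d γ⁻¹) (e ⊕ g γ⁻¹) →
              cong₂ _⊕_γ⁻¹ (distˡ₀ a b c d e g) (distˡ₁ a b c d e g))
          , (λ (a ⊕ b γ⁻¹) (c ⊕ d γ⁻¹) (e ⊕ g γ⁻¹) →
              cong₂ _⊕_γ⁻¹ (distʳ₀ a b c d e g) (distʳ₁ a b c d e g))
      }
    ; *-comm = λ (a ⊕ b γ⁻¹) (c ⊕ d γ⁻¹) →
        cong₂ _⊕_γ⁻¹ (comm₀ a b c d) (comm₁ a b c d)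
    }
  }
  where
  assoc₀ : ∀ a b c d e g →
    (a * c + b * d) * e + (a * d + b * c - b * d) * g
      ≡ a * (c * e + d * g) + b * (c * g + d * e - d * g)
  assoc₀ = solve-∀
  assoc₁ : ∀ a b c d e g →
    (a * c + b * d) * g + (a * d + b * c - b * d) * e - (a * d + b * c - b * d) * g
      ≡ a * (c * g + d * e - d * g) + b * (c * e + d * g) - b * (c * g + d * e - d * g)
  assoc₁ = solve-∀
  idˡ₀ : ∀ a b → + 1 * a + + 0 * b ≡ a
  idˡ₀ = solve-∀
  idˡ₁ : ∀ a b → + 1 * b + + 0 * a - + 0 * b ≡ b
  idˡ₁ = solve-∀
  idʳ₀ : ∀ a b → a * + 1 + b * + 0 ≡ a
  idʳ₀ = solve-∀
  idʳ₁ : ∀ a b → a * + 0 + b * + 1 - b * + 0 ≡ b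
  idʳ₁ = solve-∀
  distˡ₀ : ∀ a b c d e g →
    a * (c + e) + b * (d + g) ≡ (a * c + b * d) + (a * e + b * g)
  distˡ₀ = solve-∀
  distˡ₁ : ∀ a b c d e g →
    a * (d + g) + b * (c + e) - b * (d + g)
      ≡ (a * d + b * c - b * d) + (a * g + b * e - b * g)
  distˡ₁ = solve-∀
  distʳ₀ : ∀ a b c d e g →
    (c + e) * a + (d + g) * b ≡ (c * a + d * b) + (e * a + g * b)
  distʳ₀ = solve-∀
  distʳ₁ : ∀ a b c d e g →
    (c + e) * b + (d + g) * a - (d + g) * b
      ≡ (c * b + d * a - d * b) + (e * b + g * a - g * b)
  distʳ₁ = solve-∀
  comm₀ : ∀ a b c d → a * c + b * d ≡ c * a + d * b
  comm₀ = solve-∀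
  comm₁ : ∀ a b c d → a * d + b * c - b * d ≡ c * b + d * a - d * b
  comm₁ = solve-∀

open CommutativeRing ℤ[γ]-commutativeRing using (+-rawMonoid; semiring)
open RawSemiringDefinitions (Semiring.rawSemiring semiring) using () renaming (_^_ to infixr 8 _^ᵧ_) public

ℤ²-rawMonoid : RawMonoid 0ℓ 0ℓ
ℤ²-rawMonoid = DirectProduct.rawMonoid +-0-rawMonoid +-0-rawMonoid

-- ∑ M g (i₁, …, iₛ) = g i₁ + ⋯ + g iₛ in the additively written monoid M.
∑ : (M : RawMonoid 0ℓ 0ℓ) → (ℕ → RawMonoid.Carrier M) → ∀ {s} → Vec ℕ s → RawMonoid.Carrier M
∑ M g is = foldr′ _∙_ ε (map g is)
  where open RawMonoid M

-- The integers 0 ≤ i₁ ≤ ⋯ ≤ iₛ are natural numbers, so positivity is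
-- carried by the type.
Monotone : ∀ {s} → Vec ℕ s → Set
Monotone = Linked ℕ._≤_

Solution : ℕ → ℤ × ℤ → Pred ℕ 0ℓ
Solution d p s = ∃[ is ] Monotone {s} is
  × p ≡ ∑ ℤ²-rawMonoid (λ i → f (- (+ i)) , f (- (+ i) - + 1)) is
  × ∑ +-0-rawMonoid (λ i → f (+ i)) is ≤ + d

Expansion : ℕ → ℤ[γ] → Pred ℕ 0ℓ
Expansion d α s = ∃[ is ] Monotone {s} is
  × α ≡ ∑ +-rawMonoid (λ i → γ⁻¹ ^ᵧ i) is
  × ∑ +-0-rawMonoid (λ i → f (+ i)) is ≤ + d

IsMaximum : Pred ℕ 0ℓ → Pred ℕ 0ℓ
IsMaximum P s = P s × (∀ t → P t → t ℕ.≤ s)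

MaximalPoints : ℕ → ℕ → Pred (ℤ × ℤ) 0ℓ
MaximalPoints d s p = IsMaximum (Solution d p) s

E : ℕ → Pred ℤ[γ] 0ℓ
E d α = ∃[ s ] Expansion d α s

-- The graph of the function s_d: s[ d ] α ≐ s says that s_d(α) = s.
s[_]_≐_ : ℕ → ℤ[γ] → ℕ → Set
s[ d ] α ≐ s = IsMaximum (Expansion d α) s

E⟨_⟩ : ℕ → ℕ → Pred ℤ[γ] 0ℓ
E⟨ d ⟩ s α = E d α × s[ d ] α ≐ s

HasCardinality : {A : Set} → Pred A 0ℓ → ℕ → Set
HasCardinality P n = ∃[ xs ] Unique xs × (∀ x → x ∈ xs ⇔ P x) × length xs ≡ n

-- χ d s ≐ n says that χ_d(s) = n.
χ_,_≐_ : ℕ → ℕ → ℕ → Set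
χ d , s ≐ n = HasCardinality (MaximalPoints d s) n

{-# OPTIONS --safe #-}
-- Write x i = γ⁻ⁱ and give it the weight fib i. Splitting one x i into
-- x (1 + i) + x (2 + i) adds one term and raises the weight by
-- cost i = 2 fib (1 + i). Call a multiset of indices in a window i, 1 + i, 2 + i
-- (i occurring) active at d if its weight is at most d, but exceeds d after one
-- splitting of x i.
--
-- A linear form L with fib j ≥ L (x j) + cost i for all j, and equality on the
-- window, shows that an active multiset has the maximal number of terms among
-- the expansions of weight at most d of its value, and that it is determined
-- by its value. Conversely every nonzero element of E_d is the value of an active
-- multiset. So E_d(s), s ≥ 1, is in bijection with the multisets of size s active at d.
--
-- Such a multiset stops being active at d = weight + cost i, and it is then
-- replaced by exactly one multiset of the same size and of weight d; all
-- multisets of weight ≥ s + 2 arise once in this way. Hence |E_d(s)| is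
-- constant for d > s, and it suffices to count for d = s and d = s + 1, where
-- only windows with i = 0 matter.
module Submission where

open import Defs
open import Algebra.Bundles using (CommutativeRing)
import Data.Integer.Base as ℤ
open ℤ using (ℤ; +_; 0ℤ; 1ℤ; ∣_∣; +-0-rawMonoid)
import Data.Integer.Properties as ℤ
open import Data.Integer.Tactic.RingSolver using () renaming (solve-∀ to ℤ-solve)
open import Data.List.Base as List using (List; []; _∷_; length; upTo)
open import Data.List.Membership.Propositional using (_∈_)
open import Data.List.Membership.Propositional.Properties using (∈-upTo⁺; ∈-upTo⁻; ∈-++⁺ˡ; ∈-++⁺ʳ; ∈-++⁻)
open import Data.List.Properties using (length-upTo; length-++)
import Data.List.Relation.Unary.All as ListAll
open import Data.List.Relation.Unary.AllPairs using ([]; _∷_)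
open import Data.List.Relation.Unary.Any using (here; there)
open import Data.List.Relation.Unary.Unique.Propositional using (Unique)
open import Data.List.Relation.Unary.Unique.Propositional.Properties as Unique using (upTo⁺)
open import Data.Nat.Base using (ℕ; _+_; _*_; _<_; _>_; zero; suc; _≤_; z≤n; s≤s; s≤s⁻¹; _∸_; _⊔_)
open import Data.Nat.Properties
open import Data.Nat.Tactic.RingSolver using (solve-∀)
open import Data.Product.Base using (_×_; _,_; ∃-syntax; proj₁; proj₂)
open import Data.Sum.Base using (inj₁; inj₂)
open import Data.Vec.Base using (Vec; []; _∷_; _++_; replicate; tail)
open import Data.Vec.Relation.Unary.All as All using (All; []; _∷_)
open import Data.Vec.Relation.Unary.Linked using ([]; [-]; _∷_)
open import Function.Base using (_∘_)
open import Function.Bundles using (_⇔_; mk⇔; module Equivalence)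
open import Function.Construct.Composition using (_⇔-∘_)
open import Level using (0ℓ)
open import Relation.Binary.PropositionalEquality using (_≡_; refl; cong; cong₂; sym; trans; subst; module ≡-Reasoning)
open import Relation.Nullary.Negation using (contradiction)
open import Relation.Unary using (Pred; Empty; _∪_; _∩_)

open CommutativeRing ℤ[γ]-commutativeRing using (+-rawMonoid) renaming (+-assoc to +ᵧ-assoc; +-identityˡ to +ᵧ-identityˡ)

-- Fibonacci numbers and linear forms

fib : ℕ → ℕ
fib 0 = 1
fib 1 = 1
fib (suc (suc n)) = fib (suc n) + fib n

-- The Fibonacci-type sequence with initial values a and b. The recursion moves the pair of initial
-- values along, matching the way `∙-shift` moves a linear form.
gfib : ℕ → ℕ → ℕ → ℕ
gfib a b zero = a
gfib a b (suc k) = gfib b (b + a) k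

gfib-fib : ∀ k i → gfib (fib i) (fib (suc i)) k ≡ fib (k + i)
gfib-fib zero i = refl
gfib-fib (suc k) i = trans (gfib-fib k (suc i)) (cong fib (+-suc k i))

-- The slack c persists because the recurrence adds a nonnegative term to one that already carries
-- it.
gfib-mono : ∀ {a b a′ b′} c k → a + c ≤ a′ → b + c ≤ b′ → gfib a b k + c ≤ gfib a′ b′ k
gfib-mono c zero    a≤ b≤ = a≤
gfib-mono {a} {b} {a′} {b′} c (suc k) a≤ b≤ = gfib-mono c k b≤ (begin
  b + a + c    ≡⟨ +-assoc b a c ⟩
  b + (a + c)  ≤⟨ +-mono-≤ (m+n≤o⇒m≤o b b≤) a≤ ⟩
  b′ + a′      ∎)
  where open ≤-Reasoning

fib-pos : ∀ i → 1 ≤ fib i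
fib-pos 0 = ≤-refl
fib-pos 1 = ≤-refl
fib-pos (suc (suc i)) = ≤-trans (fib-pos (suc i)) (m≤m+n _ _)

fib-mono : ∀ i → fib i ≤ fib (suc i)
fib-mono zero = ≤-refl
fib-mono (suc i) = m≤m+n _ _

n≤fib : ∀ n → n ≤ fib n
n≤fib 0 = z≤n
n≤fib 1 = ≤-refl
n≤fib (suc (suc n)) = ≤-trans (≤-reflexive (+-comm 1 (suc n))) (+-mono-≤ (n≤fib (suc n)) (fib-pos n))

-- Multiplication by γ⁻¹, using γ⁻² = 1 - γ⁻¹.
shift : ℤ[γ] → ℤ[γ]
shift (a ⊕ b γ⁻¹) = b ⊕ a ℤ.- b γ⁻¹

x : ℕ → ℤ[γ]
x zero    = 1ᵧ
x (suc i) = shift (x i)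

infix 8 _∙_
_∙_ : ℤ × ℤ → ℤ[γ] → ℤ
(u , v) ∙ (a ⊕ b γ⁻¹) = u ℤ.* a ℤ.+ v ℤ.* b

-- A linear form is given by its values at two consecutive `x i`. `forward`, the transpose of
-- `shift`, moves this pair one index up, and `back` one index down.
forward back : ℤ × ℤ → ℤ × ℤ
forward (u , v) = v , u ℤ.- v
back (u , v) = u ℤ.+ v , u

forward-back : ∀ c → forward (back c) ≡ c
forward-back (u , v) = cong (u ,_) (eq u v)
  where
  eq : ∀ u v → u ℤ.+ v ℤ.- u ≡ v
  eq = ℤ-solve

∙-shift : ∀ c α → c ∙ shift α ≡ forward c ∙ α
∙-shift (u , v) (a ⊕ b γ⁻¹) = eq u v a b
  where
  eq : ∀ u v a b → u ℤ.* b ℤ.+ v ℤ.* (a ℤ.- b) ≡ v ℤ.* a ℤ.+ (u ℤ.- v) ℤ.* b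
  eq = ℤ-solve

∙-+ᵧ : ∀ c α β → c ∙ (α +ᵧ β) ≡ c ∙ α ℤ.+ c ∙ β
∙-+ᵧ (u , v) (a ⊕ b γ⁻¹) (a′ ⊕ b′ γ⁻¹) = eq u v a b a′ b′
  where
  eq : ∀ u v a b a′ b′ → u ℤ.* (a ℤ.+ a′) ℤ.+ v ℤ.* (b ℤ.+ b′) ≡ u ℤ.* a ℤ.+ v ℤ.* b ℤ.+ (u ℤ.* a′ ℤ.+ v ℤ.* b′)
  eq = ℤ-solve

∙-0ᵧ : ∀ c → c ∙ 0ᵧ ≡ 0ℤ
∙-0ᵧ (u , v) = eq u v
  where
  eq : ∀ u v → u ℤ.* 0ℤ ℤ.+ v ℤ.* 0ℤ ≡ 0ℤ
  eq = ℤ-solve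

∙-x₀ : ∀ c → c ∙ x 0 ≡ proj₁ c
∙-x₀ (u , v) = eq u v
  where
  eq : ∀ u v → u ℤ.* 1ℤ ℤ.+ v ℤ.* 0ℤ ≡ u
  eq = ℤ-solve

∙-x₁ : ∀ c → c ∙ x 1 ≡ proj₂ c
∙-x₁ (u , v) = eq u v
  where
  eq : ∀ u v → u ℤ.* 0ℤ ℤ.+ v ℤ.* 1ℤ ≡ v
  eq = ℤ-solve

∙-x₂ : ∀ c → c ∙ x 2 ≡ proj₁ c ℤ.- proj₂ c
∙-x₂ (u , v) = eq u v
  where
  eq : ∀ u v → u ℤ.* 1ℤ ℤ.+ v ℤ.* ℤ.-1ℤ ≡ u ℤ.- v
  eq = ℤ-solve

-- pull i (u , v) is the linear form with the values u and v at x i and x (1 + i).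
pull : ℕ → ℤ × ℤ → ℤ × ℤ
pull zero    c = c
pull (suc i) c = pull i (back c)

pull-+ : ∀ k j c → pull (k + j) c ≡ pull j (pull k c)
pull-+ zero    j c = refl
pull-+ (suc k) j c = pull-+ k j (back c)

pull-x : ∀ i k c → pull i c ∙ x (k + i) ≡ c ∙ x k
pull-x zero k c = cong (λ n → c ∙ x n) (+-identityʳ k)
pull-x (suc i) k c = begin
  pull i (back c) ∙ x (k + suc i)  ≡⟨ cong (λ n → pull i (back c) ∙ x n) (+-suc k i) ⟩
  pull i (back c) ∙ x (suc k + i)  ≡⟨ pull-x i (suc k) (back c) ⟩
  back c ∙ shift (x k)             ≡⟨ ∙-shift (back c) (x k) ⟩
  forward (back c) ∙ x k           ≡⟨ cong (_∙ x k) (forward-back c) ⟩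
  c ∙ x k                          ∎
  where open ≡-Reasoning

pull-x-below : ∀ k j c → pull (k + j) c ∙ x j ≡ proj₁ (pull k c)
pull-x-below k j c = begin
  pull (k + j) c ∙ x j       ≡⟨ cong (_∙ x j) (pull-+ k j c) ⟩
  pull j (pull k c) ∙ x j    ≡⟨ pull-x j 0 (pull k c) ⟩
  pull k c ∙ x 0             ≡⟨ ∙-x₀ (pull k c) ⟩
  proj₁ (pull k c)           ∎
  where open ≡-Reasoning

-- Values of a linear form satisfy L (x (2 + k)) = L (x k) - L (x (1 + k)), so by the triangle
-- inequality their absolute values grow no faster than the additive recurrence.
∣∙x∣≤gfib : ∀ {a b} u v k → ∣ u ∣ ≤ a → ∣ v ∣ ≤ b → ∣ (u , v) ∙ x k ∣ ≤ gfib a b k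
∣∙x∣≤gfib u v zero ∣u∣≤a ∣v∣≤b rewrite ∙-x₀ (u , v) = ∣u∣≤a
∣∙x∣≤gfib {a} {b} u v (suc k) ∣u∣≤a ∣v∣≤b rewrite ∙-shift (u , v) (x k) =
  ∣∙x∣≤gfib v (u ℤ.- v) k ∣v∣≤b
    (≤-trans (ℤ.∣i-j∣≤∣i∣+∣j∣ u v)
      (≤-trans (+-mono-≤ ∣u∣≤a ∣v∣≤b) (≤-reflexive (+-comm a b))))

i≤∣i∣ : ∀ i → i ℤ.≤ + ∣ i ∣
i≤∣i∣ (+ n) = ℤ.≤-refl
i≤∣i∣ ℤ.-[1+ n ] = ℤ.-≤+

∣i∣≤n⇒i≤n : ∀ {n} i → ∣ i ∣ ≤ n → i ℤ.≤ + n
∣i∣≤n⇒i≤n i ∣i∣≤n = ℤ.≤-trans (i≤∣i∣ i) (ℤ.+≤+ ∣i∣≤n)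

-- Linear prices

-- Splitting x i into x (1 + i) and x (2 + i) raises the weight by
-- fib (1 + i) + fib (2 + i) - fib i.
cost : ℕ → ℕ
cost i = fib (suc i) + fib (suc i)

priceStart : ℕ → ℕ → ℤ × ℤ
priceStart a b = + a ℤ.- + b ℤ.- + b , ℤ.- + b

-- The linear form taking the values fib j - cost i at x j for j = i, 1 + i
-- (and hence 2 + i).
price : ℕ → ℤ × ℤ
price i = pull i (priceStart (fib i) (fib (suc i)))

price-x₀ : ∀ i → price i ∙ x i ℤ.+ + cost i ≡ + fib i
price-x₀ i rewrite pull-x i 0 (priceStart (fib i) (fib (suc i))) = eq (+ fib i) (+ fib (suc i))
  where
  eq : ∀ a b → (a ℤ.- b ℤ.- b) ℤ.* 1ℤ ℤ.+ (ℤ.- b) ℤ.* 0ℤ ℤ.+ (b ℤ.+ b) ≡ a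
  eq = ℤ-solve

price-x₁ : ∀ i → price i ∙ x (suc i) ℤ.+ + cost i ≡ + fib (suc i)
price-x₁ i rewrite pull-x i 1 (priceStart (fib i) (fib (suc i))) = eq (+ fib i) (+ fib (suc i))
  where
  eq : ∀ a b → (a ℤ.- b ℤ.- b) ℤ.* 0ℤ ℤ.+ (ℤ.- b) ℤ.* 1ℤ ℤ.+ (b ℤ.+ b) ≡ b
  eq = ℤ-solve

price-x₂ : ∀ i → price i ∙ x (suc (suc i)) ℤ.+ + cost i ≡ + fib (suc (suc i))
price-x₂ i rewrite pull-x i 2 (priceStart (fib i) (fib (suc i))) = eq (+ fib i) (+ fib (suc i))
  where
  eq : ∀ a b → (a ℤ.- b ℤ.- b) ℤ.* 1ℤ ℤ.+ (ℤ.- b) ℤ.* (ℤ.-1ℤ) ℤ.+ (b ℤ.+ b) ≡ b ℤ.+ a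
  eq = ℤ-solve

-- Three shifts turn the starting values into (-a , 2a - b), bounded in absolute value by a and 2a +
-- b. Adding `cost i` = 2b to these bounds gives exactly fib (3 + i) and fib (4 + i), from where the
-- recurrence takes over.
price-above : ∀ i k → price i ∙ x (3 + k + i) ℤ.+ + cost i ℤ.≤ + fib (3 + k + i)
price-above i k = begin
  price i ∙ x (3 + k + i) ℤ.+ + cost i
    ≡⟨ cong (ℤ._+ + cost i) step ⟩
  (ℤ.- + a , + a ℤ.+ + a ℤ.- + b) ∙ x k ℤ.+ + cost i
    ≤⟨ ℤ.+-monoˡ-≤ (+ cost i) (∣i∣≤n⇒i≤n ((ℤ.- + a , + a ℤ.+ + a ℤ.- + b) ∙ x k) bound) ⟩
  + (gfib a (a + a + b) k + cost i)
    ≤⟨ ℤ.+≤+ (gfib-mono (cost i) k (≤-reflexive (eq₀ a b)) (≤-reflexive (eq₁ a b))) ⟩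
  + gfib (fib (3 + i)) (fib (4 + i)) k
    ≡⟨ cong +_ (gfib-fib k (3 + i)) ⟩
  + fib (k + (3 + i))
    ≡⟨ cong (λ n → + fib n) (eq₂ k i) ⟩
  + fib (3 + k + i) ∎
  where
  open ℤ.≤-Reasoning
  a b : ℕ
  a = fib i
  b = fib (suc i)
  eq₀ : ∀ a b → a + (b + b) ≡ (b + a) + b
  eq₀ = solve-∀
  eq₁ : ∀ a b → a + a + b + (b + b) ≡ (b + a) + b + (b + a)
  eq₁ = solve-∀
  eq₂ : ∀ k i → k + (3 + i) ≡ 3 + k + i
  eq₂ = solve-∀
  neg : ∀ a b → ℤ.- b ℤ.- (a ℤ.- b ℤ.- b ℤ.- (ℤ.- b)) ≡ ℤ.- a
  neg = ℤ-solve
  pos : ∀ a b → (a ℤ.- b ℤ.- b ℤ.- (ℤ.- b)) ℤ.- (ℤ.- b ℤ.- (a ℤ.- b ℤ.- b ℤ.- (ℤ.- b))) ≡ a ℤ.+ a ℤ.- b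
  pos = ℤ-solve
  c₀ : ℤ × ℤ
  c₀ = priceStart a b
  step : price i ∙ x (3 + k + i) ≡ (ℤ.- + a , + a ℤ.+ + a ℤ.- + b) ∙ x k
  step = begin-equality
    price i ∙ x (3 + k + i)               ≡⟨ pull-x i (3 + k) c₀ ⟩
    c₀ ∙ x (3 + k)                        ≡⟨ ∙-shift c₀ (x (2 + k)) ⟩
    forward c₀ ∙ x (2 + k)                ≡⟨ ∙-shift (forward c₀) (x (1 + k)) ⟩
    forward (forward c₀) ∙ x (1 + k)      ≡⟨ ∙-shift (forward (forward c₀)) (x k) ⟩
    forward (forward (forward c₀)) ∙ x k  ≡⟨ cong₂ (λ u v → (u , v) ∙ x k) (neg (+ a) (+ b)) (pos (+ a) (+ b)) ⟩
    (ℤ.- + a , + a ℤ.+ + a ℤ.- + b) ∙ x k ∎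
  bound : ∣ (ℤ.- + a , + a ℤ.+ + a ℤ.- + b) ∙ x k ∣ ≤ gfib a (a + a + b) k
  bound = ∣∙x∣≤gfib (ℤ.- + a) (+ a ℤ.+ + a ℤ.- + b) k (≤-reflexive (ℤ.∣-i∣≡∣i∣ (+ a))) (ℤ.∣i-j∣≤∣i∣+∣j∣ (+ a ℤ.+ + a) (+ b))

-- Going down, each value is the sum of the two above it, so from nonpositive starting values it can
-- only decrease.
proj₁-pull-≤ : ∀ {t} k u v → t ℤ.≤ 0ℤ → u ℤ.≤ t → v ℤ.≤ 0ℤ → proj₁ (pull k (u , v)) ℤ.≤ t
proj₁-pull-≤ zero    u v t≤0 u≤t v≤0 = u≤t
proj₁-pull-≤ {t} (suc k) u v t≤0 u≤t v≤0 = proj₁-pull-≤ k (u ℤ.+ v) u t≤0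
  (ℤ.≤-trans (ℤ.+-mono-≤ u≤t v≤0) (ℤ.≤-reflexive (ℤ.+-identityʳ t))) (ℤ.≤-trans u≤t t≤0)

-- One step below the window the price is a - 3b, at most -2b = -`cost i` because a ≤ b. Further
-- down it only decreases, so adding the cost leaves at most 0. The strictness later identifies the
-- least index of a form.
price-below : ∀ k j → price (suc k + j) ∙ x j ℤ.+ + cost (suc k + j) ℤ.< + fib j
price-below k j = begin-strict
  price (suc k + j) ∙ x j ℤ.+ + cost i  ≡⟨ cong (ℤ._+ + cost i) (pull-x-below (suc k) j (priceStart a b)) ⟩
  proj₁ (pull (suc k) (priceStart a b)) ℤ.+ + cost i  ≤⟨ ℤ.+-monoˡ-≤ (+ cost i) (proj₁-pull-≤ k _ _ neg-cost start₀ start₁) ⟩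
  ℤ.- + cost i ℤ.+ + cost i              ≡⟨ ℤ.+-inverseˡ (+ cost i) ⟩
  0ℤ                                  <⟨ ℤ.+<+ (fib-pos j) ⟩
  + fib j                             ∎
  where
  open ℤ.≤-Reasoning
  i a b : ℕ
  i = suc k + j
  a = fib i
  b = fib (suc i)
  a≤b : + a ℤ.≤ + b
  a≤b = ℤ.+≤+ (fib-mono i)
  neg-cost : ℤ.- + cost i ℤ.≤ 0ℤ
  neg-cost = ℤ.neg-mono-≤ (ℤ.+≤+ z≤n)
  eq₀ : ∀ b → b ℤ.- b ℤ.- b ℤ.+ ℤ.- b ≡ ℤ.- (b ℤ.+ b)
  eq₀ = ℤ-solve
  eq₁ : ∀ b → b ℤ.- b ℤ.- b ≡ ℤ.- b
  eq₁ = ℤ-solve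
  start₀ : + a ℤ.- + b ℤ.- + b ℤ.+ ℤ.- + b ℤ.≤ ℤ.- + cost i
  start₀ = ℤ.≤-trans (ℤ.+-monoˡ-≤ (ℤ.- + b) (ℤ.+-monoˡ-≤ (ℤ.- + b) (ℤ.+-monoˡ-≤ (ℤ.- + b) a≤b))) (ℤ.≤-reflexive (eq₀ (+ b)))
  start₁ : + a ℤ.- + b ℤ.- + b ℤ.≤ 0ℤ
  start₁ = ℤ.≤-trans (ℤ.+-monoˡ-≤ (ℤ.- + b) (ℤ.+-monoˡ-≤ (ℤ.- + b) a≤b)) (ℤ.≤-trans (ℤ.≤-reflexive (eq₁ (+ b))) (ℤ.neg-mono-≤ (ℤ.+≤+ z≤n)))

price-< : ∀ {i j} → j < i → price i ∙ x j ℤ.+ + cost i ℤ.< + fib j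
price-< {i} {j} j<i with m≤n⇒∃[o]m+o≡n j<i
... | k , refl = subst (λ n → price n ∙ x j ℤ.+ + cost n ℤ.< + fib j) (cong suc (+-comm k j)) (price-below k j)

price-≤ : ∀ i j → price i ∙ x j ℤ.+ + cost i ℤ.≤ + fib j
price-≤ i j with <-≤-connex j i
... | inj₁ j<i = ℤ.<⇒≤ (price-< j<i)
... | inj₂ i≤j with m≤n⇒∃[o]m+o≡n i≤j
...   | k , refl rewrite +-comm i k with k
...     | 0 = ℤ.≤-reflexive (price-x₀ i)
...     | 1 = ℤ.≤-reflexive (price-x₁ i)
...     | 2 = ℤ.≤-reflexive (price-x₂ i)
...     | suc (suc (suc k′)) = price-above i k′

-- Forms

Σx : ∀ {s} → Vec ℕ s → ℤ[γ]
Σx []       = 0ᵧ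
Σx (j ∷ is) = x j +ᵧ Σx is

weightᵥ : ∀ {s} → Vec ℕ s → ℕ
weightᵥ []       = 0
weightᵥ (j ∷ is) = fib j + weightᵥ is

infixr 8 _•_
_•_ : ℕ → ℤ[γ] → ℤ[γ]
n • (a ⊕ b γ⁻¹) = + n ℤ.* a ⊕ + n ℤ.* b γ⁻¹

-- The multiset of p indices i, q indices 1 + i and r indices 2 + i.
record Form : Set where
  constructor form
  field
    index p q r : ℕ

val : Form → ℤ[γ]
val (form i p q r) = p • x i +ᵧ (q • x (1 + i) +ᵧ r • x (2 + i))

weight size : Form → ℕ
weight (form i p q r) = p * fib i + (q * fib (1 + i) + r * fib (2 + i))
size (form i p q r) = p + (q + r)

indices : (τ : Form) → Vec ℕ (size τ)
indices (form i p q r) = replicate p i ++ (replicate q (1 + i) ++ replicate r (2 + i))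

•-suc : ∀ n α → suc n • α ≡ α +ᵧ n • α
•-suc n (a ⊕ b γ⁻¹) = cong₂ _⊕_γ⁻¹ (ℤ.suc-* (+ n) a) (ℤ.suc-* (+ n) b)

Σx-replicate : ∀ n j → Σx (replicate n j) ≡ n • x j
Σx-replicate zero    j = refl
Σx-replicate (suc n) j = trans (cong (x j +ᵧ_) (Σx-replicate n j)) (sym (•-suc n (x j)))

Σx-++ : ∀ {m n} (is : Vec ℕ m) (js : Vec ℕ n) → Σx (is ++ js) ≡ Σx is +ᵧ Σx js
Σx-++ []       js = sym (+ᵧ-identityˡ (Σx js))
Σx-++ (i ∷ is) js = trans (cong (x i +ᵧ_) (Σx-++ is js)) (sym (+ᵧ-assoc (x i) (Σx is) (Σx js)))

weightᵥ-replicate : ∀ n j → weightᵥ (replicate n j) ≡ n * fib j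
weightᵥ-replicate zero    j = refl
weightᵥ-replicate (suc n) j = cong (_+_ (fib j)) (weightᵥ-replicate n j)

weightᵥ-++ : ∀ {m n} (is : Vec ℕ m) (js : Vec ℕ n) → weightᵥ (is ++ js) ≡ weightᵥ is + weightᵥ js
weightᵥ-++ []       js = refl
weightᵥ-++ (i ∷ is) js = trans (cong (_+_ (fib i)) (weightᵥ-++ is js)) (sym (+-assoc (fib i) (weightᵥ is) (weightᵥ js)))

Σx-indices : ∀ τ → Σx (indices τ) ≡ val τ
Σx-indices (form i p q r) = trans (Σx-++ (replicate p i) _) (cong₂ _+ᵧ_ (Σx-replicate p i)
  (trans (Σx-++ (replicate q (1 + i)) _) (cong₂ _+ᵧ_ (Σx-replicate q (1 + i)) (Σx-replicate r (2 + i)))))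

weightᵥ-indices : ∀ τ → weightᵥ (indices τ) ≡ weight τ
weightᵥ-indices (form i p q r) = trans (weightᵥ-++ (replicate p i) _) (cong₂ _+_ (weightᵥ-replicate p i)
  (trans (weightᵥ-++ (replicate q (1 + i)) _) (cong₂ _+_ (weightᵥ-replicate q (1 + i)) (weightᵥ-replicate r (2 + i)))))

monotone-∷ : ∀ {s j} {is : Vec ℕ s} → All (j ≤_) is → Monotone is → Monotone (j ∷ is)
monotone-∷ []        []       = [-]
monotone-∷ (j≤i ∷ _) [-]      = j≤i ∷ [-]
monotone-∷ (j≤i ∷ _) (e ∷ is) = j≤i ∷ (e ∷ is)

monotone-replicate-++ : ∀ {s j} n {is : Vec ℕ s} → All (j ≤_) is → Monotone is →
  All (j ≤_) (replicate n j ++ is) × Monotone (replicate n j ++ is)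
monotone-replicate-++ zero    j≤is mono = j≤is , mono
monotone-replicate-++ (suc n) j≤is mono with monotone-replicate-++ n j≤is mono
... | j≤is′ , mono′ = ≤-refl ∷ j≤is′ , monotone-∷ j≤is′ mono′

monotone-replicate : ∀ n j → All (j ≤_) (replicate n j) × Monotone (replicate n j)
monotone-replicate zero    j = [] , []
monotone-replicate (suc n) j with monotone-replicate n j
... | j≤is , mono = ≤-refl ∷ j≤is , monotone-∷ j≤is mono

monotone-indices : ∀ τ → Monotone (indices τ)
monotone-indices (form i p q r)
  with monotone-replicate r (2 + i)
... | l₂ , m₂ with monotone-replicate-++ q (All.map (≤-trans (n≤1+n (1 + i))) l₂) m₂
...   | l₁ , m₁ = proj₂ (monotone-replicate-++ p (All.map (≤-trans (n≤1+n i)) l₁) m₁)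

∙-Σx : ∀ c t → (∀ j → c ∙ x j ℤ.+ + t ℤ.≤ + fib j) →
  ∀ {s} (is : Vec ℕ s) → c ∙ Σx is ℤ.+ + (s * t) ℤ.≤ + weightᵥ is
∙-Σx c t c≤fib [] = ℤ.≤-reflexive (cong (ℤ._+ 0ℤ) (∙-0ᵧ c))
∙-Σx c t c≤fib {suc s} (j ∷ is) = begin
  c ∙ (x j +ᵧ Σx is) ℤ.+ + (t + s * t)              ≡⟨ cong (ℤ._+ + (t + s * t)) (∙-+ᵧ c (x j) (Σx is)) ⟩
  c ∙ x j ℤ.+ c ∙ Σx is ℤ.+ (+ t ℤ.+ + (s * t))     ≡⟨ interchange (c ∙ x j) (c ∙ Σx is) (+ t) (+ (s * t)) ⟩
  (c ∙ x j ℤ.+ + t) ℤ.+ (c ∙ Σx is ℤ.+ + (s * t))   ≤⟨ ℤ.+-mono-≤ (c≤fib j) (∙-Σx c t c≤fib is) ⟩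
  + fib j ℤ.+ + weightᵥ is                          ∎
  where
  open ℤ.≤-Reasoning
  interchange : ∀ a b c d → a ℤ.+ b ℤ.+ (c ℤ.+ d) ≡ (a ℤ.+ c) ℤ.+ (b ℤ.+ d)
  interchange = ℤ-solve

∙-• : ∀ c n α → c ∙ (n • α) ≡ + n ℤ.* c ∙ α
∙-• (u , v) n (a ⊕ b γ⁻¹) = eq u v (+ n) a b
  where
  eq : ∀ u v n a b → u ℤ.* (n ℤ.* a) ℤ.+ v ℤ.* (n ℤ.* b) ≡ n ℤ.* (u ℤ.* a ℤ.+ v ℤ.* b)
  eq = ℤ-solve

∙-val : ∀ c i p q r → c ∙ val (form i p q r) ≡
  + p ℤ.* c ∙ x i ℤ.+ (+ q ℤ.* c ∙ x (1 + i) ℤ.+ + r ℤ.* c ∙ x (2 + i))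
∙-val c i p q r = begin
  c ∙ (p • x i +ᵧ (q • x (1 + i) +ᵧ r • x (2 + i)))
    ≡⟨ ∙-+ᵧ c (p • x i) _ ⟩
  c ∙ (p • x i) ℤ.+ c ∙ (q • x (1 + i) +ᵧ r • x (2 + i))
    ≡⟨ cong (ℤ._+_ (c ∙ (p • x i))) (∙-+ᵧ c (q • x (1 + i)) (r • x (2 + i))) ⟩
  c ∙ (p • x i) ℤ.+ (c ∙ (q • x (1 + i)) ℤ.+ c ∙ (r • x (2 + i)))
    ≡⟨ cong₂ ℤ._+_ (∙-• c p (x i)) (cong₂ ℤ._+_ (∙-• c q (x (1 + i))) (∙-• c r (x (2 + i)))) ⟩
  + p ℤ.* c ∙ x i ℤ.+ (+ q ℤ.* c ∙ x (1 + i) ℤ.+ + r ℤ.* c ∙ x (2 + i)) ∎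
  where open ≡-Reasoning

+-weight : ∀ i p q r → + weight (form i p q r) ≡
  + p ℤ.* + fib i ℤ.+ (+ q ℤ.* + fib (1 + i) ℤ.+ + r ℤ.* + fib (2 + i))
+-weight i p q r = cong₂ ℤ._+_ (ℤ.pos-* p (fib i)) (cong₂ ℤ._+_ (ℤ.pos-* q (fib (1 + i))) (ℤ.pos-* r (fib (2 + i))))

-- Price plus cost is exact on the window, so the estimate `∙-Σx` becomes an equality for forms.
price-val : ∀ i p q r → let τ = form i p q r in price i ∙ val τ ℤ.+ + (size τ * cost i) ≡ + weight τ
price-val i p q r = begin
  price i ∙ val τ ℤ.+ + (size τ * cost i)
    ≡⟨ cong₂ ℤ._+_ (∙-val (price i) i p q r) (ℤ.pos-* (size τ) (cost i)) ⟩
  + p ℤ.* price i ∙ x i ℤ.+ (+ q ℤ.* price i ∙ x (1 + i) ℤ.+ + r ℤ.* price i ∙ x (2 + i))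
    ℤ.+ (+ p ℤ.+ (+ q ℤ.+ + r)) ℤ.* + cost i
    ≡⟨ distribute (+ p) (+ q) (+ r) (price i ∙ x i) (price i ∙ x (1 + i)) (price i ∙ x (2 + i)) (+ cost i) ⟩
  + p ℤ.* (price i ∙ x i ℤ.+ + cost i)
    ℤ.+ (+ q ℤ.* (price i ∙ x (1 + i) ℤ.+ + cost i) ℤ.+ + r ℤ.* (price i ∙ x (2 + i) ℤ.+ + cost i))
    ≡⟨ cong₂ (λ a b → + p ℤ.* a ℤ.+ b) (price-x₀ i) (cong₂ (λ a b → + q ℤ.* a ℤ.+ + r ℤ.* b) (price-x₁ i) (price-x₂ i)) ⟩
  + p ℤ.* + fib i ℤ.+ (+ q ℤ.* + fib (1 + i) ℤ.+ + r ℤ.* + fib (2 + i))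
    ≡⟨ sym (+-weight i p q r) ⟩
  + weight τ ∎
  where
  open ≡-Reasoning
  τ : Form
  τ = form i p q r
  distribute : ∀ p q r a b c t → p ℤ.* a ℤ.+ (q ℤ.* b ℤ.+ r ℤ.* c) ℤ.+ (p ℤ.+ (q ℤ.+ r)) ℤ.* t ≡
    p ℤ.* (a ℤ.+ t) ℤ.+ (q ℤ.* (b ℤ.+ t) ℤ.+ r ℤ.* (c ℤ.+ t))
  distribute = ℤ-solve

-- Optimality and uniqueness of forms

swapʳ : ∀ a b c → a ℤ.+ b ℤ.+ c ≡ a ℤ.+ c ℤ.+ b
swapʳ = ℤ-solve

-- The price takes the same value on both expansions; compare `price-val` for τ with `∙-Σx` for
-- `is`. Thus every term beyond `size τ` raises the weight by at least the cost.
weight-optimal : ∀ τ {s} (is : Vec ℕ s) → Σx is ≡ val τ →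
  weight τ + s * cost (Form.index τ) ≤ weightᵥ is + size τ * cost (Form.index τ)
weight-optimal τ@(form i p q r) {s} is Σ≡val = ℤ.drop‿+≤+ (begin
  + weight τ ℤ.+ + (s * cost i)
    ≡⟨ cong (ℤ._+ + (s * cost i)) (sym (price-val i p q r)) ⟩
  price i ∙ val τ ℤ.+ + (size τ * cost i) ℤ.+ + (s * cost i)
    ≡⟨ swapʳ (price i ∙ val τ) (+ (size τ * cost i)) (+ (s * cost i)) ⟩
  price i ∙ val τ ℤ.+ + (s * cost i) ℤ.+ + (size τ * cost i)
    ≡⟨ cong (λ α → price i ∙ α ℤ.+ + (s * cost i) ℤ.+ + (size τ * cost i)) (sym Σ≡val) ⟩
  price i ∙ Σx is ℤ.+ + (s * cost i) ℤ.+ + (size τ * cost i)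
    ≤⟨ ℤ.+-monoˡ-≤ (+ (size τ * cost i)) (∙-Σx (price i) (cost i) (price-≤ i) is) ⟩
  + weightᵥ is ℤ.+ + (size τ * cost i) ∎)
  where open ℤ.≤-Reasoning

-- The price inequality is strict at the leading index, which lies below the window.
weight-optimal-< : ∀ τ {j s} (is : Vec ℕ s) → j < Form.index τ → Σx (j ∷ is) ≡ val τ →
  weight τ + suc s * cost (Form.index τ) < weightᵥ (j ∷ is) + size τ * cost (Form.index τ)
weight-optimal-< τ@(form i p q r) {j} {s} is j<i Σ≡val = ℤ.drop‿+<+ (begin-strict
  + weight τ ℤ.+ (+ c ℤ.+ + (s * c))
    ≡⟨ cong (ℤ._+ (+ c ℤ.+ + (s * c))) (sym (price-val i p q r)) ⟩
  price i ∙ val τ ℤ.+ + (size τ * c) ℤ.+ (+ c ℤ.+ + (s * c))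
    ≡⟨ cong (λ α → α ℤ.+ + (size τ * c) ℤ.+ (+ c ℤ.+ + (s * c)))
         (trans (cong (price i ∙_) (sym Σ≡val)) (∙-+ᵧ (price i) (x j) (Σx is))) ⟩
  price i ∙ x j ℤ.+ price i ∙ Σx is ℤ.+ + (size τ * c) ℤ.+ (+ c ℤ.+ + (s * c))
    ≡⟨ regroup (price i ∙ x j) (price i ∙ Σx is) (+ (size τ * c)) (+ c) (+ (s * c)) ⟩
  (price i ∙ x j ℤ.+ + c) ℤ.+ (price i ∙ Σx is ℤ.+ + (s * c)) ℤ.+ + (size τ * c)
    <⟨ ℤ.+-monoˡ-< (+ (size τ * c)) (ℤ.+-mono-<-≤ (price-< j<i) (∙-Σx (price i) c (price-≤ i) is)) ⟩
  + fib j ℤ.+ + weightᵥ is ℤ.+ + (size τ * c) ∎)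
  where
  open ℤ.≤-Reasoning
  c : ℕ
  c = cost i
  regroup : ∀ a b n c m → a ℤ.+ b ℤ.+ n ℤ.+ (c ℤ.+ m) ≡ (a ℤ.+ c) ℤ.+ (b ℤ.+ m) ℤ.+ n
  regroup = ℤ-solve

-- For equal sizes the cost terms cancel. Used in both directions, this gives equal weights.
weight-unique : ∀ σ τ → val σ ≡ val τ → size σ ≡ size τ → weight σ ≤ weight τ
weight-unique σ τ vσ≡vτ sσ≡sτ = +-cancelʳ-≤ (size σ * cost (Form.index σ)) (weight σ) (weight τ) (begin
  weight σ + size σ * cost (Form.index σ)             ≡⟨ cong (λ n → weight σ + n * cost (Form.index σ)) sσ≡sτ ⟩
  weight σ + size τ * cost (Form.index σ)             ≤⟨ weight-optimal σ (indices τ) (trans (Σx-indices τ) (sym vσ≡vτ)) ⟩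
  weightᵥ (indices τ) + size σ * cost (Form.index σ)  ≡⟨ cong (_+ size σ * cost (Form.index σ)) (weightᵥ-indices τ) ⟩
  weight τ + size σ * cost (Form.index σ)             ∎)
  where open ≤-Reasoning

-- A multiset with indices in a window of length three has several encodings;
-- p ≥ 1 makes index its least element.
data Canonical : Form → Set where
  canonical : ∀ {i p q r} → Canonical (form i (suc p) q r)

-- Were the least index of τ below that of σ, the price of σ would be strict there and τ would be
-- heavier than σ. Canonicity puts that index at the head of `indices τ`.
index-unique-≤ : ∀ σ {τ} → Canonical τ → val σ ≡ val τ → size σ ≡ size τ → Form.index σ ≤ Form.index τ
index-unique-≤ σ {τ@(form j (suc p) q r)} canonical vσ≡vτ sσ≡sτ with ≤-<-connex (Form.index σ) j
... | inj₁ i≤j = i≤j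
... | inj₂ j<i = contradiction (weight-unique τ σ (sym vσ≡vτ) (sym sσ≡sτ)) (<⇒≱ (+-cancelʳ-< (size τ * cost i) (weight σ) (weight τ) (begin-strict
  weight σ + size τ * cost i             <⟨ weight-optimal-< σ (tail (indices τ)) j<i (trans (Σx-indices τ) (sym vσ≡vτ)) ⟩
  weightᵥ (indices τ) + size σ * cost i  ≡⟨ cong₂ _+_ (weightᵥ-indices τ) (cong (_* cost i) sσ≡sτ) ⟩
  weight τ + size τ * cost i             ∎)))
  where
  open ≤-Reasoning
  i : ℕ
  i = Form.index σ

-- The linear forms with values 1, 1, 0 and 1, 0, 1 on the window read off p + q and p + r; together
-- with the size these determine all three multiplicities.
val-injective-at : ∀ i p q r p′ q′ r′ → val (form i p q r) ≡ val (form i p′ q′ r′) → p + (q + r) ≡ p′ + (q′ + r′) →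
  form i p q r ≡ form i p′ q′ r′
val-injective-at i p q r p′ q′ r′ v≡v′ s≡s′ = goal p≡p′ q≡q′ r≡r′
  where
  goal : p ≡ p′ → q ≡ q′ → r ≡ r′ → form i p q r ≡ form i p′ q′ r′
  goal refl refl refl = refl
  coordinate : ∀ u v p q r → pull i (u , v) ∙ val (form i p q r) ≡ + p ℤ.* u ℤ.+ (+ q ℤ.* v ℤ.+ + r ℤ.* (u ℤ.- v))
  coordinate u v p q r = trans (∙-val (pull i (u , v)) i p q r)
    (cong₂ (λ a b → + p ℤ.* a ℤ.+ b) (trans (pull-x i 0 (u , v)) (∙-x₀ (u , v)))
      (cong₂ (λ a b → + q ℤ.* a ℤ.+ + r ℤ.* b)
        (trans (pull-x i 1 (u , v)) (∙-x₁ (u , v))) (trans (pull-x i 2 (u , v)) (∙-x₂ (u , v)))))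
  same : ∀ u v → + p ℤ.* u ℤ.+ (+ q ℤ.* v ℤ.+ + r ℤ.* (u ℤ.- v)) ≡ + p′ ℤ.* u ℤ.+ (+ q′ ℤ.* v ℤ.+ + r′ ℤ.* (u ℤ.- v))
  same u v = trans (sym (coordinate u v p q r)) (trans (cong (pull i (u , v) ∙_) v≡v′) (coordinate u v p′ q′ r′))
  eq₁ : ∀ p q r → p ℤ.* 1ℤ ℤ.+ (q ℤ.* 1ℤ ℤ.+ r ℤ.* 0ℤ) ≡ p ℤ.+ q
  eq₁ = ℤ-solve
  eq₂ : ∀ p q r → p ℤ.* 1ℤ ℤ.+ (q ℤ.* 0ℤ ℤ.+ r ℤ.* 1ℤ) ≡ p ℤ.+ r
  eq₂ = ℤ-solve
  p+q≡ : p + q ≡ p′ + q′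
  p+q≡ = ℤ.+-injective (trans (sym (eq₁ (+ p) (+ q) (+ r))) (trans (same 1ℤ 1ℤ) (eq₁ (+ p′) (+ q′) (+ r′))))
  p+r≡ : p + r ≡ p′ + r′
  p+r≡ = ℤ.+-injective (trans (sym (eq₂ (+ p) (+ q) (+ r))) (trans (same 1ℤ 0ℤ) (eq₂ (+ p′) (+ q′) (+ r′))))
  r≡r′ : r ≡ r′
  r≡r′ = +-cancelˡ-≡ (p + q) r r′ (trans (+-assoc p q r) (trans s≡s′ (trans (sym (+-assoc p′ q′ r′)) (cong (_+ r′) (sym p+q≡)))))
  p≡p′ : p ≡ p′
  p≡p′ = +-cancelʳ-≡ r p p′ (trans p+r≡ (cong (_+_ p′) (sym r≡r′)))
  q≡q′ : q ≡ q′
  q≡q′ = +-cancelˡ-≡ p q q′ (trans p+q≡ (cong (_+ q′) (sym p≡p′)))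

val-injective : ∀ {σ τ} → Canonical σ → Canonical τ → val σ ≡ val τ → size σ ≡ size τ → σ ≡ τ
val-injective {σ@(form i p q r)} {τ@(form j p′ q′ r′)} cσ cτ vσ≡vτ sσ≡sτ
  with ≤-antisym (index-unique-≤ σ cτ vσ≡vτ sσ≡sτ) (index-unique-≤ τ cσ (sym vσ≡vτ) (sym sσ≡sτ))
... | refl = val-injective-at i p q r p′ q′ r′ vσ≡vτ sσ≡sτ

cost-form : Form → ℕ
cost-form τ = cost (Form.index τ)

Active : ℕ → Form → Set
Active d τ = weight τ ≤ d × d < weight τ + cost-form τ

-- Expansions and active forms

x≡γ⁻¹^ : ∀ i → x i ≡ γ⁻¹ ^ᵧ i
x≡γ⁻¹^ zero    = refl
x≡γ⁻¹^ (suc i) = trans (cong shift (x≡γ⁻¹^ i)) (shift≡γ⁻¹* (γ⁻¹ ^ᵧ i))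
  where
  eq₀ : ∀ a b → b ≡ 0ℤ ℤ.* a ℤ.+ 1ℤ ℤ.* b
  eq₀ = ℤ-solve
  eq₁ : ∀ a b → a ℤ.- b ≡ 0ℤ ℤ.* b ℤ.+ 1ℤ ℤ.* a ℤ.- 1ℤ ℤ.* b
  eq₁ = ℤ-solve
  shift≡γ⁻¹* : ∀ α → shift α ≡ γ⁻¹ *ᵧ α
  shift≡γ⁻¹* (a ⊕ b γ⁻¹) = cong₂ _⊕_γ⁻¹ (eq₀ a b) (eq₁ a b)

f-fib : ∀ n → f (+ n) ≡ + fib n
f-fib 0 = refl
f-fib 1 = refl
f-fib (suc (suc n)) = cong₂ ℤ._+_ (f-fib (suc n)) (f-fib n)

∑-x : ∀ {s} (is : Vec ℕ s) → ∑ +-rawMonoid (λ i → γ⁻¹ ^ᵧ i) is ≡ Σx is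
∑-x []       = refl
∑-x (i ∷ is) = cong₂ _+ᵧ_ (sym (x≡γ⁻¹^ i)) (∑-x is)

∑-f : ∀ {s} (is : Vec ℕ s) → ∑ +-0-rawMonoid (λ i → f (+ i)) is ≡ + weightᵥ is
∑-f []       = refl
∑-f (i ∷ is) = cong₂ ℤ._+_ (f-fib i) (∑-f is)

expansion⁻ : ∀ {d α s} → Expansion d α s → ∃[ is ] Σx {s} is ≡ α × weightᵥ is ≤ d
expansion⁻ (is , _ , α≡∑ , ∑f≤d) =
  is , sym (trans α≡∑ (∑-x is)) , ℤ.drop‿+≤+ (subst (ℤ._≤ _) (∑-f is) ∑f≤d)

expansion⁺ : ∀ {d} τ → weight τ ≤ d → Expansion d (val τ) (size τ)
expansion⁺ τ w≤d = indices τ , monotone-indices τ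
  , sym (trans (∑-x (indices τ)) (Σx-indices τ))
  , subst (ℤ._≤ _) (sym (trans (∑-f (indices τ)) (cong +_ (weightᵥ-indices τ)))) (ℤ.+≤+ w≤d)

-- One more term than `size τ` already costs `cost-form τ` in weight, which overshoots d.
active⇒maximum : ∀ {d} τ → Active d τ → s[ d ] val τ ≐ size τ
active⇒maximum {d} τ (w≤d , d<w+c) = expansion⁺ τ w≤d , bounded
  where
  open ≤-Reasoning
  c : ℕ
  c = cost-form τ
  bounded : ∀ t → Expansion d (val τ) t → t ≤ size τ
  bounded t e with expansion⁻ e | ≤-<-connex t (size τ)
  ... | _ | inj₁ t≤s = t≤s
  ... | is , Σ≡ , wᵥ≤d | inj₂ s<t = contradiction (+-cancelʳ-≤ (size τ * c) (weight τ + c) d (begin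
    weight τ + c + size τ * c       ≡⟨ +-assoc (weight τ) c (size τ * c) ⟩
    weight τ + suc (size τ) * c     ≤⟨ +-monoʳ-≤ (weight τ) (*-monoˡ-≤ c s<t) ⟩
    weight τ + t * c                ≤⟨ weight-optimal τ is Σ≡ ⟩
    weightᵥ is + size τ * c         ≤⟨ +-monoˡ-≤ (size τ * c) wᵥ≤d ⟩
    d + size τ * c                  ∎)) (<⇒≱ d<w+c)

-- Lower bounds for the weight

∙-Σx-≤ : ∀ u v → ∣ u ∣ ≤ 1 → ∣ v ∣ ≤ 1 → ∀ {s} (is : Vec ℕ s) → (u , v) ∙ Σx is ℤ.≤ + weightᵥ is
∙-Σx-≤ u v ∣u∣≤1 ∣v∣≤1 {s} is = begin
  (u , v) ∙ Σx is                ≡⟨ ℤ.+-identityʳ _ ⟨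
  (u , v) ∙ Σx is ℤ.+ 0ℤ         ≡⟨ cong (λ n → (u , v) ∙ Σx is ℤ.+ + n) (*-zeroʳ s) ⟨
  (u , v) ∙ Σx is ℤ.+ + (s * 0)  ≤⟨ ∙-Σx (u , v) 0 bound is ⟩
  + weightᵥ is                   ∎
  where
  open ℤ.≤-Reasoning
  bound : ∀ j → (u , v) ∙ x j ℤ.+ 0ℤ ℤ.≤ + fib j
  bound j = begin
    (u , v) ∙ x j ℤ.+ 0ℤ   ≡⟨ ℤ.+-identityʳ _ ⟩
    (u , v) ∙ x j          ≤⟨ ∣i∣≤n⇒i≤n _ (∣∙x∣≤gfib u v j ∣u∣≤1 ∣v∣≤1) ⟩
    + gfib 1 1 j           ≡⟨ cong +_ (gfib-fib j 0) ⟩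
    + fib (j + 0)          ≡⟨ cong (λ n → + fib n) (+-identityʳ j) ⟩
    + fib j                ∎

-- A form with coefficients of absolute value at most 1 is bounded by fib j at x j, hence by the
-- weight of any expansion. If τ attains the bound, it is the lightest expansion of its value.
tight⇒≤ : ∀ u v → ∣ u ∣ ≤ 1 → ∣ v ∣ ≤ 1 → ∀ τ → (u , v) ∙ val τ ≡ + weight τ →
  ∀ {s} (is : Vec ℕ s) → Σx is ≡ val τ → weight τ ≤ weightᵥ is
tight⇒≤ u v ∣u∣≤1 ∣v∣≤1 τ tight is Σ≡val = ℤ.drop‿+≤+
  (subst (ℤ._≤ _) (trans (cong ((u , v) ∙_) Σ≡val) tight) (∙-Σx-≤ u v ∣u∣≤1 ∣v∣≤1 is))

sgn : ℕ → ℤ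
sgn zero    = 1ℤ
sgn (suc i) = ℤ.- sgn i

∣sgn∣ : ∀ i → ∣ sgn i ∣ ≡ 1
∣sgn∣ zero    = refl
∣sgn∣ (suc i) = trans (ℤ.∣-i∣≡∣i∣ (sgn i)) (∣sgn∣ i)

-- The values of the linear form (1 , -1) at the x i alternate in sign, and equal
-- ± fib i.
sgn-∙-x : ∀ a b i → (sgn i ℤ.* + a , ℤ.- (sgn i ℤ.* + b)) ∙ x i ≡ + gfib a b i
sgn-∙-x a b zero = trans (∙-x₀ (1ℤ ℤ.* + a , ℤ.- (1ℤ ℤ.* + b))) (ℤ.*-identityˡ (+ a))
sgn-∙-x a b (suc i) = begin
  (ℤ.- sgn i ℤ.* + a , ℤ.- (ℤ.- sgn i ℤ.* + b)) ∙ shift (x i)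
    ≡⟨ ∙-shift (ℤ.- sgn i ℤ.* + a , ℤ.- (ℤ.- sgn i ℤ.* + b)) (x i) ⟩
  (ℤ.- (ℤ.- sgn i ℤ.* + b) , ℤ.- sgn i ℤ.* + a ℤ.- ℤ.- (ℤ.- sgn i ℤ.* + b)) ∙ x i
    ≡⟨ cong₂ (λ u v → (u , v) ∙ x i) (eq₀ (sgn i) (+ b)) (eq₁ (sgn i) (+ a) (+ b)) ⟩
  (sgn i ℤ.* + b , ℤ.- (sgn i ℤ.* (+ b ℤ.+ + a))) ∙ x i
    ≡⟨ sgn-∙-x b (b + a) i ⟩
  + gfib b (b + a) i ∎
  where
  open ≡-Reasoning
  eq₀ : ∀ s b → ℤ.- (ℤ.- s ℤ.* b) ≡ s ℤ.* b
  eq₀ = ℤ-solve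
  eq₁ : ∀ s a b → ℤ.- s ℤ.* a ℤ.- ℤ.- (ℤ.- s ℤ.* b) ≡ ℤ.- (s ℤ.* (b ℤ.+ a))
  eq₁ = ℤ-solve

alternating : ℤ → ℤ × ℤ
alternating σ = σ , ℤ.- σ

alternating-x : ∀ i → alternating (sgn i) ∙ x i ≡ + fib i
alternating-x i = begin
  (sgn i , ℤ.- sgn i) ∙ x i                        ≡⟨ cong (λ u → (u , ℤ.- u) ∙ x i) (ℤ.*-identityʳ (sgn i)) ⟨
  (sgn i ℤ.* 1ℤ , ℤ.- (sgn i ℤ.* 1ℤ)) ∙ x i        ≡⟨ sgn-∙-x 1 1 i ⟩
  + gfib 1 1 i                                     ≡⟨ cong +_ (gfib-fib i 0) ⟩
  + fib (i + 0)                                    ≡⟨ cong (λ n → + fib n) (+-identityʳ i) ⟩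
  + fib i                                          ∎
  where open ≡-Reasoning

-- Indices i and 2 + i have equal parity, so with the sign of i the alternating form is exact on
-- every term as long as 1 + i does not occur.
gap⇒≤ : ∀ i p r {s} (is : Vec ℕ s) → Σx is ≡ val (form i p 0 r) → weight (form i p 0 r) ≤ weightᵥ is
gap⇒≤ i p r = tight⇒≤ σ (ℤ.- σ) (≤-reflexive (∣sgn∣ i)) (≤-reflexive (trans (ℤ.∣-i∣≡∣i∣ σ) (∣sgn∣ i)))
  (form i p 0 r) (begin
  alternating σ ∙ val (form i p 0 r)
    ≡⟨ ∙-val (alternating σ) i p 0 r ⟩
  + p ℤ.* alternating σ ∙ x i ℤ.+ (0ℤ ℤ.* alternating σ ∙ x (1 + i) ℤ.+ + r ℤ.* alternating σ ∙ x (2 + i))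
    ≡⟨ cong₂ (λ a b → + p ℤ.* a ℤ.+ (0ℤ ℤ.+ + r ℤ.* b)) (alternating-x i)
         (trans (cong (λ u → alternating u ∙ x (2 + i)) (sym (ℤ.neg-involutive σ))) (alternating-x (2 + i))) ⟩
  + p ℤ.* + fib i ℤ.+ (0ℤ ℤ.+ + r ℤ.* + fib (2 + i))
    ≡⟨ +-weight i p 0 r ⟨
  + weight (form i p 0 r) ∎)
  where
  open ≡-Reasoning
  σ : ℤ
  σ = sgn i

-- The form (1 , 1) takes the value 1, the weight of a single term, at both x 0 and x 1.
origin⇒≤ : ∀ p q {s} (is : Vec ℕ s) → Σx is ≡ val (form 0 p q 0) → weight (form 0 p q 0) ≤ weightᵥ is
origin⇒≤ p q = tight⇒≤ 1ℤ 1ℤ ≤-refl ≤-refl (form 0 p q 0)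
  (trans (∙-val (1ℤ , 1ℤ) 0 p q 0) (sym (+-weight 0 p q 0)))

-- Moving windows, and descent to an active form

val-split : ∀ i p q r → val (form i (suc p) q r) ≡ val (form i p (suc q) (suc r))
val-split i p q r = cong₂ _⊕_γ⁻¹
  (eq (+ p) (+ q) (+ r) (ℤ[γ].coeff₀ (x i)) (ℤ[γ].coeff₁ (x i)))
  (eq (+ p) (+ q) (+ r) (ℤ[γ].coeff₁ (x i)) (ℤ[γ].coeff₀ (x i) ℤ.- ℤ[γ].coeff₁ (x i)))
  where
  eq : ∀ p q r a b → (1ℤ ℤ.+ p) ℤ.* a ℤ.+ (q ℤ.* b ℤ.+ r ℤ.* (a ℤ.- b)) ≡
    p ℤ.* a ℤ.+ ((1ℤ ℤ.+ q) ℤ.* b ℤ.+ (1ℤ ℤ.+ r) ℤ.* (a ℤ.- b))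
  eq = ℤ-solve

weight-split : ∀ i p q r → weight (form i p (suc q) (suc r)) ≡ weight (form i (suc p) q r) + cost i
weight-split i p q r = eq p q r (fib i) (fib (suc i))
  where
  eq : ∀ p q r a b → p * a + ((b + q * b) + (b + a + r * (b + a))) ≡ (a + p * a) + (q * b + r * (b + a)) + (b + b)
  eq = solve-∀

val-reindex : ∀ i q r → val (form i 0 q r) ≡ val (form (suc i) q r 0)
val-reindex i q r = cong₂ _⊕_γ⁻¹
  (eq (+ q) (+ r) (ℤ[γ].coeff₀ (x i)) (ℤ[γ].coeff₁ (x i)))
  (eq (+ q) (+ r) (ℤ[γ].coeff₁ (x i)) (ℤ[γ].coeff₀ (x i) ℤ.- ℤ[γ].coeff₁ (x i)))
  where
  eq : ∀ q r a b → 0ℤ ℤ.* a ℤ.+ (q ℤ.* b ℤ.+ r ℤ.* (a ℤ.- b)) ≡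
    q ℤ.* b ℤ.+ (r ℤ.* (a ℤ.- b) ℤ.+ 0ℤ ℤ.* (b ℤ.- (a ℤ.- b)))
  eq = ℤ-solve

weight-reindex : ∀ i q r → weight (form i 0 q r) ≡ weight (form (suc i) q r 0)
weight-reindex i q r = cong (_+_ (q * fib (1 + i))) (sym (+-identityʳ (r * fib (2 + i))))

size-reindex : ∀ i q r → size (form i 0 q r) ≡ size (form (suc i) q r 0)
size-reindex i q r = cong (_+_ q) (sym (+-identityʳ r))

-- All p copies of x i are split at once.
val-grow : ∀ i p q → val (form i p q 0) ≡ val (form (suc i) (p + q) p 0)
val-grow i p q = cong₂ _⊕_γ⁻¹
  (eq (+ p) (+ q) (ℤ[γ].coeff₀ (x i)) (ℤ[γ].coeff₁ (x i)))
  (eq (+ p) (+ q) (ℤ[γ].coeff₁ (x i)) (ℤ[γ].coeff₀ (x i) ℤ.- ℤ[γ].coeff₁ (x i)))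
  where
  eq : ∀ p q a b → p ℤ.* a ℤ.+ (q ℤ.* b ℤ.+ 0ℤ ℤ.* (a ℤ.- b)) ≡
    (p ℤ.+ q) ℤ.* b ℤ.+ (p ℤ.* (a ℤ.- b) ℤ.+ 0ℤ ℤ.* (b ℤ.- (a ℤ.- b)))
  eq = ℤ-solve

-- The cone of nonnegative combinations of x i and x (1 + i). These cones increase with i, which
-- brings all terms of an expansion into a single window.
InCone : ℕ → ℤ[γ] → Set
InCone i α = ∃[ p ] ∃[ q ] α ≡ val (form i p q 0)

inCone-+ᵧ : ∀ {i α β} → InCone i α → InCone i β → InCone i (α +ᵧ β)
inCone-+ᵧ {i} (p , q , refl) (p′ , q′ , refl) = p + p′ , q + q′ , cong₂ _⊕_γ⁻¹
  (eq (+ p) (+ q) (+ p′) (+ q′) (ℤ[γ].coeff₀ (x i)) (ℤ[γ].coeff₁ (x i)))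
  (eq (+ p) (+ q) (+ p′) (+ q′) (ℤ[γ].coeff₁ (x i)) (ℤ[γ].coeff₀ (x i) ℤ.- ℤ[γ].coeff₁ (x i)))
  where
  eq : ∀ p q p′ q′ a b →
    p ℤ.* a ℤ.+ (q ℤ.* b ℤ.+ 0ℤ ℤ.* (a ℤ.- b)) ℤ.+ (p′ ℤ.* a ℤ.+ (q′ ℤ.* b ℤ.+ 0ℤ ℤ.* (a ℤ.- b))) ≡
    (p ℤ.+ p′) ℤ.* a ℤ.+ ((q ℤ.+ q′) ℤ.* b ℤ.+ 0ℤ ℤ.* (a ℤ.- b))
  eq = ℤ-solve

inCone-mono : ∀ {i j α} → i ≤ j → InCone i α → InCone j α
inCone-mono {i} {α = α} i≤j cone with m≤n⇒∃[o]m+o≡n i≤j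
... | k , refl = subst (λ n → InCone n α) (+-comm k i) (grow k cone)
  where
  grow : ∀ {α} k → InCone i α → InCone (k + i) α
  grow zero    cone = cone
  grow (suc k) cone with grow k cone
  ... | p , q , refl = p + q , p , val-grow (k + i) p q

inCone-x : ∀ j → InCone j (x j)
inCone-x j = 1 , 0 , cong₂ _⊕_γ⁻¹
  (eq (ℤ[γ].coeff₀ (x j)) (ℤ[γ].coeff₁ (x j)))
  (eq (ℤ[γ].coeff₁ (x j)) (ℤ[γ].coeff₀ (x j) ℤ.- ℤ[γ].coeff₁ (x j)))
  where
  eq : ∀ a b → a ≡ 1ℤ ℤ.* a ℤ.+ (0ℤ ℤ.* b ℤ.+ 0ℤ ℤ.* (a ℤ.- b))
  eq = ℤ-solve

-- The bound d ≤ i makes `cost i` exceed d, as the start of the descent requires.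
Σx-inCone : ∀ d {s} (is : Vec ℕ s) → ∃[ i ] d ≤ i × InCone i (Σx is)
Σx-inCone d []       = d , ≤-refl , 0 , 0 , refl
Σx-inCone d (j ∷ is) with Σx-inCone d is
... | i , d≤i , cone = j ⊔ i , ≤-trans d≤i (m≤n⊔m j i)
    , inCone-+ᵧ {j ⊔ i} (inCone-mono (m≤m⊔n j i) (inCone-x j)) (inCone-mono (m≤n⊔m j i) cone)

-- Recombine splittings and lower the index until the weight is at most d.
-- The two ways of getting stuck are excluded by a linear form with
-- coefficients ±1 that bounds all weights below and is attained by the stuck
-- form.
descend : ∀ {d} i p q r {s} (is : Vec ℕ s) → Σx is ≡ val (form i p q r) → weightᵥ is ≤ d →
  d < weight (form i p q r) + cost i → ∃[ τ ] Σx is ≡ val τ × Active d τ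
descend {d} i p q r is Σ≡ wᵥ≤d d<w+c with ≤-<-connex (weight (form i p q r)) d
descend i p q r is Σ≡ wᵥ≤d d<w+c | inj₁ w≤d = form i p q r , Σ≡ , w≤d , d<w+c
descend i p (suc q) (suc r) is Σ≡ wᵥ≤d d<w+c | inj₂ d<w =
  descend i (suc p) q r is (trans Σ≡ (sym (val-split i p q r))) wᵥ≤d
    (<-≤-trans d<w (≤-reflexive (weight-split i p q r)))
descend i p zero r is Σ≡ wᵥ≤d d<w+c | inj₂ d<w =
  contradiction (≤-trans (gap⇒≤ i p r is Σ≡) wᵥ≤d) (<⇒≱ d<w)
descend zero p (suc q) zero is Σ≡ wᵥ≤d d<w+c | inj₂ d<w =
  contradiction (≤-trans (origin⇒≤ p (suc q) is Σ≡) wᵥ≤d) (<⇒≱ d<w)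
-- The same multiset seen from one index lower, with p = 0. As its weight alone exceeds d, the bound
-- holds with the new cost as well.
descend (suc i) p (suc q) zero is Σ≡ wᵥ≤d d<w+c | inj₂ d<w =
  descend i 0 p (suc q) is (trans Σ≡ (sym (val-reindex i p (suc q)))) wᵥ≤d
    (<-≤-trans d<w (≤-trans (≤-reflexive (sym (weight-reindex i p (suc q)))) (m≤m+n _ _)))

expansion⇒active : ∀ {d α s} → Expansion d α s → ∃[ τ ] α ≡ val τ × Active d τ
expansion⇒active {d} e with expansion⁻ e
... | is , refl , wᵥ≤d with Σx-inCone d is
...   | i , d≤i , p , q , Σ≡ = descend i p q 0 is Σ≡ wᵥ≤d
  -- d < 1 + i ≤ fib (1 + i) ≤ `cost i`.
  (≤-trans (s≤s d≤i) (≤-trans (n≤fib (suc i)) (≤-trans (m≤m+n (fib (suc i)) (fib (suc i))) (m≤n+m (cost i) (weight (form i p q 0))))))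

maximum-unique : ∀ {P s t} → IsMaximum P s → IsMaximum P t → s ≡ t
maximum-unique (Ps , s-max) (Pt , t-max) = ≤-antisym (t-max _ Ps) (s-max _ Pt)

E⇒active : ∀ {d s α} → E⟨ d ⟩ s α → ∃[ τ ] α ≡ val τ × size τ ≡ s × Active d τ
E⇒active ((_ , e) , max) with expansion⇒active e
... | τ , refl , act = τ , refl , maximum-unique (active⇒maximum τ act) max , act

active⇒E : ∀ {d} τ → Active d τ → E⟨ d ⟩ (size τ) (val τ)
active⇒E τ act = (size τ , proj₁ max) , max
  where
  max = active⇒maximum τ act

-- Cardinalities

-- A bijection between the elements satisfying P and those satisfying Q, given by its graph. It
-- relates elements rather than pairs with proofs, and is inverted by swapping arguments.
record Correspondence {A B : Set} (P : Pred A 0ℓ) (Q : Pred B 0ℓ) : Set₁ where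
  field
    _~_        : A → B → Set
    sound      : ∀ {a b} → a ~ b → P a × Q b
    total      : ∀ {a} → P a → ∃[ b ] a ~ b
    surjective : ∀ {b} → Q b → ∃[ a ] a ~ b
    functional : ∀ {a b b′} → a ~ b → a ~ b′ → b ≡ b′
    injective  : ∀ {a a′ b} → a ~ b → a′ ~ b → a ≡ a′

inverse : ∀ {A B : Set} {P : Pred A 0ℓ} {Q : Pred B 0ℓ} → Correspondence P Q → Correspondence Q P
inverse R = record
  { _~_ = λ b a → a ~ b ; sound = λ a~b → proj₂ (sound a~b) , proj₁ (sound a~b)
  ; total = surjective ; surjective = total ; functional = injective ; injective = functional }
  where open Correspondence R

transfer : ∀ {A B : Set} {P : Pred A 0ℓ} {Q : Pred B 0ℓ} {n} → Correspondence P Q →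
  HasCardinality P n → HasCardinality Q n
transfer {A} {B} {P} {Q} R (as , as! , ∈⇔P , refl) = finish (image as as! (Equivalence.to (∈⇔P _)))
  where
  open Correspondence R
  Image : List A → Set
  Image as = ∃[ bs ] Unique bs × (∀ {b} → b ∈ bs → ∃[ a ] a ∈ as × a ~ b)
    × (∀ {a b} → a ∈ as → a ~ b → b ∈ bs) × length bs ≡ length as
  image : ∀ as → Unique as → (∀ {a} → a ∈ as → P a) → Image as
  image [] [] _ = [] , [] , (λ ()) , (λ ()) , refl
  image (a ∷ as) (a∉as ∷ as!) ∈⇒P with total (∈⇒P (here refl)) | image as as! (∈⇒P ∘ there)
  ... | b , a~b | bs , bs! , back , forth , eq =
    b ∷ bs , ListAll.tabulate b∉bs ∷ bs! , back′ , forth′ , cong suc eq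
    where
    b∉bs : ∀ {b′} → b′ ∈ bs → b ≡ b′ → _
    b∉bs b∈bs refl with back b∈bs
    ... | a′ , a′∈as , a′~b = ListAll.lookup a∉as a′∈as (injective a~b a′~b)
    back′ : ∀ {b′} → b′ ∈ b ∷ bs → ∃[ a′ ] a′ ∈ a ∷ as × a′ ~ b′
    back′ (here refl) = a , here refl , a~b
    back′ (there b∈bs) with back b∈bs
    ... | a′ , a′∈as , a′~b = a′ , there a′∈as , a′~b
    forth′ : ∀ {a′ b′} → a′ ∈ a ∷ as → a′ ~ b′ → b′ ∈ b ∷ bs
    forth′ (here refl)  a~b′ = here (functional a~b′ a~b)
    forth′ (there a∈as) a~b′ = there (forth a∈as a~b′)
  finish : Image as → HasCardinality Q (length as)
  finish (bs , bs! , back , forth , eq) = bs , bs! , (λ b → mk⇔ ∈⇒Q Q⇒∈) , eq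
    where
    ∈⇒Q : ∀ {b} → b ∈ bs → Q b
    ∈⇒Q b∈bs with back b∈bs
    ... | _ , _ , a~b = proj₂ (sound a~b)
    Q⇒∈ : ∀ {b} → Q b → b ∈ bs
    Q⇒∈ Qb with surjective Qb
    ... | a , a~b = forth (Equivalence.from (∈⇔P a) (proj₁ (sound a~b))) a~b

cardinality-⇔ : ∀ {A : Set} {P Q : Pred A 0ℓ} {n} → (∀ a → P a ⇔ Q a) → HasCardinality P n → HasCardinality Q n
cardinality-⇔ P⇔Q (as , as! , ∈⇔P , eq) = as , as! , (λ a → P⇔Q a ⇔-∘ ∈⇔P a) , eq

cardinality-∪ : ∀ {A : Set} {P Q : Pred A 0ℓ} {m n} → Empty (P ∩ Q) →
  HasCardinality P m → HasCardinality Q n → HasCardinality (P ∪ Q) (m + n)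
cardinality-∪ disjoint (as , as! , ∈⇔P , refl) (bs , bs! , ∈⇔Q , refl) =
  as List.++ bs
  , Unique.++⁺ as! bs! (λ (a∈as , a∈bs) → disjoint _ (Equivalence.to (∈⇔P _) a∈as , Equivalence.to (∈⇔Q _) a∈bs))
  , (λ a → mk⇔ (to a) (from a))
  , length-++ as
  where
  to : ∀ a → a ∈ as List.++ bs → _
  to a a∈ with ∈-++⁻ as a∈
  ... | inj₁ a∈as = inj₁ (Equivalence.to (∈⇔P a) a∈as)
  ... | inj₂ a∈bs = inj₂ (Equivalence.to (∈⇔Q a) a∈bs)
  from : ∀ a → _ → a ∈ as List.++ bs
  from a (inj₁ Pa) = ∈-++⁺ˡ (Equivalence.from (∈⇔P a) Pa)
  from a (inj₂ Qa) = ∈-++⁺ʳ as (Equivalence.from (∈⇔Q a) Qa)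

cardinality-< : ∀ n → HasCardinality (_< n) n
cardinality-< n = upTo n , upTo⁺ n , (λ k → mk⇔ ∈-upTo⁻ ∈-upTo⁺) , length-upTo n

-- Succession of forms

-- next τ has the size of τ and the weight at which τ stops being active: one
-- index i moves to 3 + i if it is the only one, otherwise two indices i move
-- to 2 + i.
next : Form → Form
next (form i 0 q r)                   = form i 0 q r
next (form i 1 (suc q) r)             = form (1 + i) (suc q) r 1
next (form i 1 0 (suc r))             = form (2 + i) (suc r) 1 0
next (form i 1 0 0)                   = form (3 + i) 1 0 0
next (form i 2 (suc q) r)             = form (1 + i) (suc q) (2 + r) 0
next (form i 2 0 r)                   = form (2 + i) (2 + r) 0 0
next (form i (suc (suc (suc p))) q r) = form i (suc p) q (2 + r)

-- A left inverse of `next` on canonical forms. Among these, the default clause is reached only by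
-- forms of weight at most size + 1.
prev : Form → Form
prev (form i p q (suc (suc r)))         = form i (2 + p) q r
prev (form (suc i) p q 1)               = form i 1 p q
prev (form (suc i) p (suc (suc q)) 0)   = form i 2 p q
prev (form (suc (suc i)) p 1 0)         = form i 1 0 p
prev (form (suc (suc i)) (suc (suc p)) 0 0) = form i 2 0 p
prev (form (suc (suc (suc i))) 1 0 0)   = form i 1 0 0
prev τ                                  = τ

prev-next : ∀ {τ} → Canonical τ → prev (next τ) ≡ τ
prev-next {form i 1 (suc q) r}             canonical = refl
prev-next {form i 1 0 (suc r)}             canonical = refl
prev-next {form i 1 0 0}                   canonical = refl
prev-next {form i 2 (suc q) r}             canonical = refl
prev-next {form i 2 0 r}                   canonical = refl
prev-next {form i (suc (suc (suc p))) q r} canonical = refl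

next-canonical : ∀ {τ} → Canonical τ → Canonical (next τ)
next-canonical {form i 1 (suc q) r}             canonical = canonical
next-canonical {form i 1 0 (suc r)}             canonical = canonical
next-canonical {form i 1 0 0}                   canonical = canonical
next-canonical {form i 2 (suc q) r}             canonical = canonical
next-canonical {form i 2 0 r}                   canonical = canonical
next-canonical {form i (suc (suc (suc p))) q r} canonical = canonical

size-next : ∀ {τ} → Canonical τ → size (next τ) ≡ size τ
size-next {form i 1 (suc q) r}             canonical = eq q r
  where
  eq : ∀ q r → suc q + (r + 1) ≡ 1 + (suc q + r)
  eq = solve-∀
size-next {form i 1 0 (suc r)}             canonical = eq r
  where
  eq : ∀ r → suc r + (1 + 0) ≡ 1 + (0 + suc r)
  eq = solve-∀
size-next {form i 1 0 0}                   canonical = refl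
size-next {form i 2 (suc q) r}             canonical = eq q r
  where
  eq : ∀ q r → suc q + ((2 + r) + 0) ≡ 2 + (suc q + r)
  eq = solve-∀
size-next {form i 2 0 r}                   canonical = eq r
  where
  eq : ∀ r → (2 + r) + (0 + 0) ≡ 2 + (0 + r)
  eq = solve-∀
size-next {form i (suc (suc (suc p))) q r} canonical = eq p q r
  where
  eq : ∀ p q r → suc p + (q + (2 + r)) ≡ (3 + p) + (q + r)
  eq = solve-∀

-- Both moves cost the same: fib (3 + i) - fib i = 2 (fib (2 + i) - fib i) = `cost i`.
weight-next : ∀ {τ} → Canonical τ → weight (next τ) ≡ weight τ + cost-form τ
weight-next {form i 1 (suc q) r}             canonical = eq q r (fib i) (fib (suc i))
  where
  eq : ∀ q r a b → suc q * b + (r * (b + a) + 1 * (b + a + b)) ≡ 1 * a + (suc q * b + r * (b + a)) + (b + b)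
  eq = solve-∀
weight-next {form i 1 0 (suc r)}             canonical = eq r (fib i) (fib (suc i))
  where
  eq : ∀ r a b → suc r * (b + a) + (1 * (b + a + b) + 0 * (b + a + b + (b + a))) ≡ 1 * a + (0 * b + suc r * (b + a)) + (b + b)
  eq = solve-∀
weight-next {form i 1 0 0}                   canonical = eq (fib i) (fib (suc i))
  where
  eq : ∀ a b → 1 * (b + a + b) + 0 ≡ 1 * a + 0 + (b + b)
  eq = solve-∀
weight-next {form i 2 (suc q) r}             canonical = eq q r (fib i) (fib (suc i))
  where
  eq : ∀ q r a b → suc q * b + ((2 + r) * (b + a) + 0) ≡ 2 * a + (suc q * b + r * (b + a)) + (b + b)
  eq = solve-∀
weight-next {form i 2 0 r}                   canonical = eq r (fib i) (fib (suc i))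
  where
  eq : ∀ r a b → (2 + r) * (b + a) + 0 ≡ 2 * a + (0 * b + r * (b + a)) + (b + b)
  eq = solve-∀
weight-next {form i (suc (suc (suc p))) q r} canonical = eq p q r (fib i) (fib (suc i))
  where
  eq : ∀ p q r a b → suc p * a + (q * b + (2 + r) * (b + a)) ≡ (3 + p) * a + (q * b + r * (b + a)) + (b + b)
  eq = solve-∀

next-surjective : ∀ {τ} → Canonical τ → suc (size τ) < weight τ → ∃[ σ ] Canonical σ × next σ ≡ τ
next-surjective {form i (suc p) q (suc (suc r))} canonical _ = form i (3 + p) q r , canonical , refl
next-surjective {form (suc i) (suc p) q 1} canonical _ = form i 1 (suc p) q , canonical , refl
next-surjective {form (suc i) (suc p) (suc (suc q)) 0} canonical _ = form i 2 (suc p) q , canonical , refl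
next-surjective {form (suc (suc i)) (suc p) 1 0} canonical _ = form i 1 0 (suc p) , canonical , refl
next-surjective {form (suc (suc i)) (suc (suc p)) 0 0} canonical _ = form i 2 0 p , canonical , refl
next-surjective {form (suc (suc (suc i))) 1 0 0} canonical _ = form i 1 0 0 , canonical , refl
-- What remains are multisets of indices 0 and 1 with at most one index 2; their weight is at most
-- size + 1.
next-surjective {form 0 (suc p) q 1} canonical s<w = contradiction s<w (≤⇒≯ (≤-reflexive (eq p q)))
  where
  eq : ∀ p q → suc p * 1 + (q * 1 + 1 * 2) ≡ suc (suc p + (q + 1))
  eq = solve-∀
next-surjective {form 0 (suc p) q 0} canonical s<w = contradiction s<w (≤⇒≯ (≤-trans (≤-reflexive (eq p q)) (n≤1+n _)))
  where
  eq : ∀ p q → suc p * 1 + (q * 1 + 0) ≡ suc p + (q + 0)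
  eq = solve-∀
next-surjective {form 1 (suc p) 1 0} canonical s<w = contradiction s<w (≤⇒≯ (≤-reflexive (eq p)))
  where
  eq : ∀ p → suc p * 1 + (1 * 2 + 0) ≡ suc (suc p + (1 + 0))
  eq = solve-∀
next-surjective {form 1 (suc p) 0 0} canonical s<w = contradiction s<w (≤⇒≯ (≤-trans (≤-reflexive (eq p)) (n≤1+n _)))
  where
  eq : ∀ p → suc p * 1 + 0 ≡ suc p + (0 + 0)
  eq = solve-∀
next-surjective {form 2 1 0 0} canonical s<w = contradiction s<w (≤⇒≯ ≤-refl)

CanonicalActive : ℕ → ℕ → Pred Form 0ℓ
CanonicalActive d s τ = Canonical τ × size τ ≡ s × Active d τ

cost-pos : ∀ i → 1 ≤ cost i
cost-pos i = ≤-trans (fib-pos (suc i)) (m≤m+n _ _)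

-- Raising the index past absent elements keeps the multiset and its weight, and can only increase
-- the cost, so activity survives.
canonicalise : ∀ {d} τ → 1 ≤ size τ → Active d τ → ∃[ σ ] val τ ≡ val σ × CanonicalActive d (size τ) σ
canonicalise τ@(form i (suc p) q r) _ act = τ , refl , canonical , refl , act
canonicalise {d} (form i 0 (suc q) r) _ (w≤d , d<w+c) =
  σ , val-reindex i (suc q) r , canonical , sym (size-reindex i (suc q) r)
  , subst (_≤ d) w≡ w≤d , <-≤-trans d<w+c (+-mono-≤ (≤-reflexive w≡) (+-mono-≤ (fib-mono (suc i)) (fib-mono (suc i))))
  where
  σ : Form
  σ = form (suc i) (suc q) r 0
  w≡ : weight (form i 0 (suc q) r) ≡ weight σ
  w≡ = weight-reindex i (suc q) r
canonicalise {d} (form i 0 0 (suc r)) _ (w≤d , d<w+c) =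
  σ , trans (val-reindex i 0 (suc r)) (val-reindex (suc i) (suc r) 0) , canonical
  , +-identityʳ (suc r)
  , subst (_≤ d) w≡ w≤d
  , <-≤-trans d<w+c (+-mono-≤ (≤-reflexive w≡) (+-mono-≤ c≤ c≤))
  where
  σ : Form
  σ = form (2 + i) (suc r) 0 0
  w≡ : weight (form i 0 0 (suc r)) ≡ weight σ
  w≡ = trans (weight-reindex i 0 (suc r)) (weight-reindex (suc i) (suc r) 0)
  c≤ : fib (1 + i) ≤ fib (3 + i)
  c≤ = ≤-trans (fib-mono (suc i)) (fib-mono (2 + i))

-- Canonical forms are nonempty, whence 1 ≤ s. Injectivity is uniqueness of a form for its value and
-- size; surjectivity is the descent followed by canonicalisation.
val-correspondence : ∀ {d s} → 1 ≤ s → Correspondence (CanonicalActive d s) (E⟨ d ⟩ s)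
val-correspondence {d} {s} 1≤s = record
  { _~_ = λ τ α → CanonicalActive d s τ × val τ ≡ α
  ; sound = λ { {τ} (can@(_ , refl , act) , refl) → can , active⇒E τ act }
  ; total = λ act → _ , act , refl
  ; surjective = surj
  ; functional = λ { (_ , refl) (_ , refl) → refl }
  ; injective = λ { ((c , s≡ , _) , v≡) ((c′ , s′≡ , _) , v′≡) →
      val-injective c c′ (trans v≡ (sym v′≡)) (trans s≡ (sym s′≡)) }
  }
  where
  surj : ∀ {α} → E⟨ d ⟩ s α → ∃[ τ ] CanonicalActive d s τ × val τ ≡ α
  surj e with E⇒active e
  ... | τ , refl , refl , act with canonicalise τ 1≤s act
  ...   | σ , v≡ , act′ = σ , act′ , sym v≡

-- From d to 1 + d a form either remains active, or its activity ends exactly at 1 + d and `next`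
-- takes over.
data Step (d : ℕ) : Form → Form → Set where
  stay : ∀ {τ} → weight τ ≤ d → suc d < weight τ + cost-form τ → Step d τ τ
  move : ∀ {τ} → Canonical τ → weight τ + cost-form τ ≡ suc d → Step d τ (next τ)

step-correspondence : ∀ {d s} → s < d → Correspondence (CanonicalActive d s) (CanonicalActive (suc d) s)
step-correspondence {d} {s} s<d = record
  { _~_ = λ σ τ → Step d σ τ × Canonical σ × size σ ≡ s
  ; sound = sound
  ; total = total
  ; surjective = surjective
  ; functional = functional
  ; injective = injective
  }
  where
  sound : ∀ {σ τ} → Step d σ τ × Canonical σ × size σ ≡ s → CanonicalActive d s σ × CanonicalActive (suc d) s τ
  sound (stay w≤d d<w+c , can , s≡) =
    (can , s≡ , w≤d , <-trans ≤-refl d<w+c) , (can , s≡ , m≤n⇒m≤1+n w≤d , d<w+c)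
  sound (move {τ} can end , _ , s≡) =
    (can , s≡ , s≤s⁻¹ (subst (weight τ <_) end (m<m+n (weight τ) (cost-pos (Form.index τ)))) , ≤-reflexive (sym end))
    , (next-canonical can , trans (size-next can) s≡ , ≤-reflexive w≡
      , subst (λ w → suc d < w + cost-form (next τ)) (sym w≡) (m<m+n (suc d) (cost-pos (Form.index (next τ)))))
    where
    w≡ : weight (next τ) ≡ suc d
    w≡ = trans (weight-next can) end
  total : ∀ {σ} → CanonicalActive d s σ → ∃[ τ ] Step d σ τ × Canonical σ × size σ ≡ s
  total {σ} (can , s≡ , w≤d , d<w+c) with m≤n⇒m<n∨m≡n d<w+c
  ... | inj₁ 1+d<w+c = σ , stay w≤d 1+d<w+c , can , s≡
  ... | inj₂ 1+d≡w+c = next σ , move can (sym 1+d≡w+c) , can , s≡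
  surjective : ∀ {τ} → CanonicalActive (suc d) s τ → ∃[ σ ] Step d σ τ × Canonical σ × size σ ≡ s
  surjective {τ} (can , s≡ , w≤1+d , 1+d<w+c) with m≤n⇒m<n∨m≡n w≤1+d
  ... | inj₁ (s≤s w≤d) = τ , stay w≤d 1+d<w+c , can , s≡
  -- Here s < d enters: the weight 1 + d exceeds s + 1, so a preimage under `next` exists.
  ... | inj₂ w≡1+d with next-surjective can (≤-trans (s≤s (≤-trans (≤-reflexive (cong suc s≡)) s<d)) (≤-reflexive (sym w≡1+d)))
  ...   | σ , can′ , refl = σ , move can′ (trans (sym (weight-next can′)) w≡1+d) , can′ , trans (sym (size-next can′)) s≡
  functional : ∀ {σ τ τ′} → Step d σ τ × Canonical σ × size σ ≡ s → Step d σ τ′ × Canonical σ × size σ ≡ s → τ ≡ τ′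
  functional (stay _ _ , _)     (stay _ _ , _)     = refl
  functional (stay _ d<end , _) (move _ end , _)   = contradiction (sym end) (<⇒≢ d<end)
  functional (move _ end , _)   (stay _ d<end , _) = contradiction (sym end) (<⇒≢ d<end)
  functional (move _ _ , _)     (move _ _ , _)     = refl
  -- Staying gives weight at most d, moving gives 1 + d, so mixed cases are impossible. Two separate
  -- targets joined by an equation avoid unifying two applications of `next`.
  meet : ∀ {σ σ′ τ τ′} → Step d σ τ → Step d σ′ τ′ → τ ≡ τ′ → σ ≡ σ′
  meet (stay _ _)     (stay _ _)      τ≡τ′ = τ≡τ′
  meet (stay w≤d _)   (move can end)  refl = contradiction w≤d (<⇒≱ (≤-reflexive (sym (trans (weight-next can) end))))
  meet (move can end) (stay w≤d _)    refl = contradiction w≤d (<⇒≱ (≤-reflexive (sym (trans (weight-next can) end))))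
  meet (move can _)   (move can′ _)   τ≡τ′ = trans (sym (prev-next can)) (trans (cong prev τ≡τ′) (prev-next can′))
  injective : ∀ {σ σ′ τ} → Step d σ τ × Canonical σ × size σ ≡ s → Step d σ′ τ × Canonical σ′ × size σ′ ≡ s → σ ≡ σ′
  injective (step , _) (step′ , _) = meet step step′ refl

-- The base cases d = s and d = s + 1

-- The values of multisets of s indices among 0, 1, 2 in which 2 occurs exactly r times.
Row : ℕ → ℕ → Pred ℤ[γ] 0ℓ
Row r s α = ∃[ p ] ∃[ q ] size (form 0 p q r) ≡ s × val (form 0 p q r) ≡ α

-- The multiplicity p of the index 0 ranges over 0, ..., n and determines the rest.
cardinality-Row : ∀ r n → HasCardinality (Row r (n + r)) (suc n)
cardinality-Row r n = transfer correspondence (cardinality-< (suc n))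
  where
  k≤n : ∀ {k q} → k + (q + r) ≡ n + r → k ≤ n
  k≤n {k} {q} s≡ = m+n≤o⇒m≤o k (≤-reflexive (+-cancelʳ-≡ r (k + q) n (trans (+-assoc k q r) s≡)))
  correspondence : Correspondence (_< suc n) (Row r (n + r))
  correspondence = record
    { _~_ = λ p α → ∃[ q ] size (form 0 p q r) ≡ n + r × val (form 0 p q r) ≡ α
    ; sound = λ { {p} (q , s≡ , v≡) → s≤s (k≤n s≡) , p , q , s≡ , v≡ }
    ; total = λ { {p} (s≤s p≤n) → _ , n ∸ p
        , trans (sym (+-assoc p _ r)) (cong (_+ r) (m+[n∸m]≡n p≤n)) , refl }
    ; surjective = λ (p , row) → p , row
    ; functional = λ { {p} (q , s≡ , refl) (q′ , s′≡ , refl) →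
        cong (λ q → val (form 0 p q r)) (+-cancelʳ-≡ r q q′ (+-cancelˡ-≡ p _ _ (trans s≡ (sym s′≡)))) }
    ; injective = λ { {p} {p′} (q , s≡ , v≡) (q′ , s′≡ , v′≡) →
        cong Form.p (val-injective-at 0 p q r p′ q′ r (trans v≡ (sym v′≡)) (trans s≡ (sym s′≡))) }
    }

val-+p : ∀ i p q r → x i +ᵧ val (form i p q r) ≡ val (form i (suc p) q r)
val-+p i p q r = trans (sym (+ᵧ-assoc (x i) (p • x i) _)) (cong (_+ᵧ _) (sym (•-suc p (x i))))

val-+q : ∀ i p q r → x (1 + i) +ᵧ val (form i p q r) ≡ val (form i p (suc q) r)
val-+q i p q r = cong₂ _⊕_γ⁻¹
  (eq (+ p) (+ q) (+ r) (ℤ[γ].coeff₀ (x i)) (ℤ[γ].coeff₁ (x i)))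
  (eq (+ p) (+ q) (+ r) (ℤ[γ].coeff₁ (x i)) (ℤ[γ].coeff₀ (x i) ℤ.- ℤ[γ].coeff₁ (x i)))
  where
  eq : ∀ p q r a b → b ℤ.+ (p ℤ.* a ℤ.+ (q ℤ.* b ℤ.+ r ℤ.* (a ℤ.- b))) ≡
    p ℤ.* a ℤ.+ ((1ℤ ℤ.+ q) ℤ.* b ℤ.+ r ℤ.* (a ℤ.- b))
  eq = ℤ-solve

val-+r : ∀ i p q r → x (2 + i) +ᵧ val (form i p q r) ≡ val (form i p q (suc r))
val-+r i p q r = cong₂ _⊕_γ⁻¹
  (eq (+ p) (+ q) (+ r) (ℤ[γ].coeff₀ (x i)) (ℤ[γ].coeff₁ (x i)))
  (eq (+ p) (+ q) (+ r) (ℤ[γ].coeff₁ (x i)) (ℤ[γ].coeff₀ (x i) ℤ.- ℤ[γ].coeff₁ (x i)))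
  where
  eq : ∀ p q r a b → (a ℤ.- b) ℤ.+ (p ℤ.* a ℤ.+ (q ℤ.* b ℤ.+ r ℤ.* (a ℤ.- b))) ≡
    p ℤ.* a ℤ.+ (q ℤ.* b ℤ.+ (1ℤ ℤ.+ r) ℤ.* (a ℤ.- b))
  eq = ℤ-solve

s≤weightᵥ : ∀ {s} (is : Vec ℕ s) → s ≤ weightᵥ is
s≤weightᵥ []       = z≤n
s≤weightᵥ (j ∷ is) = +-mono-≤ (fib-pos j) (s≤weightᵥ is)

-- With weight at most the number of terms, every term must weigh exactly 1.
light⇒Row₀ : ∀ {s} (is : Vec ℕ s) → weightᵥ is ≤ s → Row 0 s (Σx is)
light⇒Row₀ [] _ = 0 , 0 , refl , refl
light⇒Row₀ (0 ∷ is) (s≤s w≤s) with light⇒Row₀ is w≤s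
... | p , q , s≡ , v≡ = suc p , q , cong suc s≡ , trans (sym (val-+p 0 p q 0)) (cong (x 0 +ᵧ_) v≡)
light⇒Row₀ (1 ∷ is) (s≤s w≤s) with light⇒Row₀ is w≤s
... | p , q , s≡ , v≡ = p , suc q , trans (+-suc p (q + 0)) (cong suc s≡) , trans (sym (val-+q 0 p q 0)) (cong (x 1 +ᵧ_) v≡)
light⇒Row₀ (suc (suc j) ∷ is) w≤s = contradiction w≤s (<⇒≱ (+-mono-≤ (+-mono-≤ (fib-pos (suc j)) (fib-pos j)) (s≤weightᵥ is)))

light⇒Row₀∪Row₁ : ∀ {s} (is : Vec ℕ s) → weightᵥ is ≤ suc s → (Row 0 s ∪ Row 1 s) (Σx is)
light⇒Row₀∪Row₁ [] _ = inj₁ (0 , 0 , refl , refl)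
light⇒Row₀∪Row₁ (0 ∷ is) (s≤s w≤s) with light⇒Row₀∪Row₁ is w≤s
... | inj₁ (p , q , s≡ , v≡) = inj₁ (suc p , q , cong suc s≡ , trans (sym (val-+p 0 p q 0)) (cong (x 0 +ᵧ_) v≡))
... | inj₂ (p , q , s≡ , v≡) = inj₂ (suc p , q , cong suc s≡ , trans (sym (val-+p 0 p q 1)) (cong (x 0 +ᵧ_) v≡))
light⇒Row₀∪Row₁ (1 ∷ is) (s≤s w≤s) with light⇒Row₀∪Row₁ is w≤s
... | inj₁ (p , q , s≡ , v≡) = inj₁ (p , suc q , trans (+-suc p (q + 0)) (cong suc s≡) , trans (sym (val-+q 0 p q 0)) (cong (x 1 +ᵧ_) v≡))
... | inj₂ (p , q , s≡ , v≡) = inj₂ (p , suc q , trans (+-suc p (q + 1)) (cong suc s≡) , trans (sym (val-+q 0 p q 1)) (cong (x 1 +ᵧ_) v≡))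
-- The index 2 uses up the one spare unit of weight, so the remaining indices are 0 or 1.
light⇒Row₀∪Row₁ (2 ∷ is) (s≤s (s≤s w≤s)) with light⇒Row₀ is w≤s
... | p , q , s≡ , v≡ = inj₂ (p , q , trans (cong (_+_ p) (+-suc q 0)) (trans (+-suc p (q + 0)) (cong suc s≡)) , trans (sym (val-+r 0 p q 0)) (cong (x 2 +ᵧ_) v≡))
light⇒Row₀∪Row₁ (suc (suc (suc j)) ∷ is) w≤s = contradiction w≤s
  (<⇒≱ (+-mono-≤ (+-mono-≤ (+-mono-≤ (fib-pos (suc j)) (fib-pos j)) (fib-pos (suc j))) (s≤weightᵥ is)))

weight-Row : ∀ p q r → weight (form 0 p q r) ≡ size (form 0 p q r) + r
weight-Row p q r = eq p q r
  where
  eq : ∀ p q r → p * 1 + (q * 1 + r * 2) ≡ p + (q + r) + r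
  eq = solve-∀

-- The weight is s + r and `cost 0` = 2, so these forms are active for d = s + r and d = s + r + 1.
Row⇒E : ∀ {d s} r → s + r ≤ d → d < s + r + 2 → ∀ {α} → Row r s α → E⟨ d ⟩ s α
Row⇒E {d} r s+r≤d d<s+r+2 (p , q , refl , refl) = active⇒E (form 0 p q r)
  ( subst (_≤ d) (sym (weight-Row p q r)) s+r≤d
  , subst (λ w → d < w + 2) (sym (weight-Row p q r)) d<s+r+2 )

cardinality-diagonal : ∀ s → HasCardinality (E⟨ s ⟩ s) (suc s)
cardinality-diagonal s = cardinality-⇔ (λ α → mk⇔ (Row⇒E 0 (≤-reflexive (+-identityʳ s)) s<s+0+2) to)
  (subst (λ n → HasCardinality (Row 0 n) (suc s)) (+-identityʳ s) (cardinality-Row 0 s))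
  where
  s<s+0+2 : s < s + 0 + 2
  s<s+0+2 = ≤-<-trans (≤-reflexive (sym (+-identityʳ s))) (m<m+n (s + 0) (s≤s z≤n))
  to : ∀ {α} → E⟨ s ⟩ s α → Row 0 s α
  to (_ , e , _) with expansion⁻ e
  ... | is , refl , w≤s = light⇒Row₀ is w≤s

-- At weight at most s + 1 there are s + 1 values without an index 2 and s values with exactly one.
cardinality-superdiagonal : ∀ s → 1 ≤ s → HasCardinality (E⟨ suc s ⟩ s) (2 * s + 1)
cardinality-superdiagonal s@(suc n) _ = subst (HasCardinality (E⟨ suc s ⟩ s)) (count n)
  (cardinality-⇔ (λ α → mk⇔ from to) (cardinality-∪ disjoint
    (subst (λ m → HasCardinality (Row 0 m) (suc s)) (+-identityʳ s) (cardinality-Row 0 s))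
    (subst (λ m → HasCardinality (Row 1 m) s) (+-comm n 1) (cardinality-Row 1 n))))
  where
  count : ∀ n → suc (suc n) + suc n ≡ 2 * suc n + 1
  count = solve-∀
  disjoint : Empty (Row 0 s ∩ Row 1 s)
  disjoint α ((p , q , s≡ , v≡) , (p′ , q′ , s′≡ , v′≡))
    = 0≢1+n (cong Form.r (val-injective-at 0 p q 0 p′ q′ 1 (trans v≡ (sym v′≡)) (trans s≡ (sym s′≡))))
  bound₀ : suc s < s + 0 + 2
  bound₀ = ≤-reflexive (eq s)
    where
    eq : ∀ s → suc (suc s) ≡ s + 0 + 2
    eq = solve-∀
  bound₁ : suc s < s + 1 + 2
  bound₁ = ≤-trans (n≤1+n _) (≤-reflexive (eq s))
    where
    eq : ∀ s → suc (suc (suc s)) ≡ s + 1 + 2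
    eq = solve-∀
  from : ∀ {α} → (Row 0 s ∪ Row 1 s) α → E⟨ suc s ⟩ s α
  from (inj₁ row) = Row⇒E 0 (≤-trans (≤-reflexive (+-identityʳ s)) (n≤1+n s)) bound₀ row
  from (inj₂ row) = Row⇒E 1 (≤-reflexive (+-comm s 1)) bound₁ row
  to : ∀ {α} → E⟨ suc s ⟩ s α → (Row 0 s ∪ Row 1 s) α
  to (_ , e , _) with expansion⁻ e
  ... | is , refl , w≤1+s = light⇒Row₀∪Row₁ is w≤1+s

-- Cardinalities for all d

cardinality-zero : ∀ d → HasCardinality (E⟨ d ⟩ 0) 1
cardinality-zero d = 0ᵧ ∷ [] , ListAll.[] ∷ [] , (λ α → mk⇔ to from) , refl
  where
  to : ∀ {α} → α ∈ 0ᵧ ∷ [] → E⟨ d ⟩ 0 α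
  -- The empty multiset may carry any index; d is taken because `cost d` exceeds d.
  to (here refl) = active⇒E (form d 0 0 0) (z≤n , ≤-trans (n≤fib (suc d)) (m≤m+n _ _))
  from : ∀ {α} → E⟨ d ⟩ 0 α → α ∈ 0ᵧ ∷ []
  from (_ , ([] , _ , α≡0 , _) , _) = here α≡0

-- Induction on k = d - (s + 1) along the step correspondence, starting from d = s + 1.
cardinality-canonical : ∀ s k → 1 ≤ s → HasCardinality (CanonicalActive (k + suc s) s) (2 * s + 1)
cardinality-canonical s zero    1≤s = transfer (inverse (val-correspondence 1≤s)) (cardinality-superdiagonal s 1≤s)
cardinality-canonical s (suc k) 1≤s = transfer (step-correspondence (m≤n+m (suc s) k)) (cardinality-canonical s k 1≤s)

cardinality-E : ∀ d s → s < d → HasCardinality (E⟨ d ⟩ s) (2 * s + 1)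
cardinality-E d zero    _   = cardinality-zero d
cardinality-E d s@(suc _) s<d with m≤n⇒∃[o]m+o≡n s<d
... | k , refl = subst (λ n → HasCardinality (E⟨ n ⟩ s) (2 * s + 1)) (+-comm k (suc s))
  (transfer (val-correspondence (s≤s z≤n)) (cardinality-canonical s k (s≤s z≤n)))

E-empty : ∀ d s → s > d → Empty (E⟨ d ⟩ s)
E-empty d s d<s α (_ , e , _) with expansion⁻ e
... | is , _ , w≤d = <⇒≱ d<s (≤-trans (s≤weightᵥ is) w≤d)

-- Passage from ℤ[γ] to ℤ²

x-f : ∀ i → x i ≡ f (ℤ.- (+ i)) ⊕ f (ℤ.- (+ i) ℤ.- 1ℤ) γ⁻¹
x-f zero    = refl
-- Subtracting 1 from `-[1+ n ]` computes to `-[1+ suc (n + 0) ]`.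
x-f (suc n) rewrite +-identityʳ n = negative n
  where
  negative : ∀ n → x (suc n) ≡ f ℤ.-[1+ n ] ⊕ f ℤ.-[1+ suc n ] γ⁻¹
  negative zero    = refl
  -- The recursion defining `f` at negative arguments is the second coordinate of `shift`.
  negative (suc n) = cong shift (negative n)

point : ℤ × ℤ → ℤ[γ]
point (m , n) = m ⊕ n γ⁻¹

∑-point : ∀ {s} (is : Vec ℕ s) →
  point (∑ ℤ²-rawMonoid (λ i → f (ℤ.- (+ i)) , f (ℤ.- (+ i) ℤ.- + 1)) is) ≡ ∑ +-rawMonoid (λ i → γ⁻¹ ^ᵧ i) is
∑-point []       = refl
∑-point (i ∷ is) = cong₂ _+ᵧ_ (trans (sym (x-f i)) (x≡γ⁻¹^ i)) (∑-point is)

solution⇒expansion : ∀ {d p s} → Solution d p s → Expansion d (point p) s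
solution⇒expansion (is , mono , p≡ , w) = is , mono , trans (cong point p≡) (∑-point is) , w

expansion⇒solution : ∀ {d p s} → Expansion d (point p) s → Solution d p s
expansion⇒solution (is , mono , α≡ , w) =
  is , mono , cong (λ α → ℤ[γ].coeff₀ α , ℤ[γ].coeff₁ α) (trans α≡ (sym (∑-point is))) , w

point-correspondence : ∀ d s → Correspondence (E⟨ d ⟩ s) (MaximalPoints d s)
point-correspondence d s = record
  { _~_ = λ α p → E⟨ d ⟩ s α × point p ≡ α
  ; sound = λ { (e@(_ , ex , max) , refl) → e , expansion⇒solution ex , λ t sol → max t (solution⇒expansion sol) }
  ; total = λ e → _ , e , refl
  ; surjective = λ { (sol , max) → _ , ((s , solution⇒expansion sol) , solution⇒expansion sol , λ t ex → max t (expansion⇒solution ex)) , refl }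
  ; functional = λ { (_ , refl) (_ , refl) → refl }
  ; injective = λ { (_ , refl) (_ , refl) → refl }
  }

mainTheorem1 : (d s : ℕ) →
    ((s < d → χ d , s ≐ (2 * s + 1)) ×
    (s ≡ d → χ d , s ≐ (d + 1)) ×
    (s > d → χ d , s ≐ 0)) ×
    ((s > d → Empty (E⟨ d ⟩ s)) ×
    (s < d → HasCardinality (E⟨ d ⟩ s) (2 * s + 1)) ×
    (s ≡ d → HasCardinality (E⟨ d ⟩ s) (d + 1)))
mainTheorem1 d s =
  ( (λ s<d → transfer (point-correspondence d s) (cardinality-E d s s<d))
  , (λ s≡d → transfer (point-correspondence d s) (diagonal s≡d))
  , (λ s>d → transfer (point-correspondence d s) (empty s>d)) )
  , E-empty d s , cardinality-E d s , diagonal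
  where
  diagonal : s ≡ d → HasCardinality (E⟨ d ⟩ s) (d + 1)
  diagonal refl = subst (HasCardinality (E⟨ d ⟩ d)) (+-comm 1 d) (cardinality-diagonal d)
  empty : s > d → HasCardinality (E⟨ d ⟩ s) 0
  empty s>d = [] , [] , (λ α → mk⇔ (λ ()) (λ e → contradiction e (E-empty d s s>d α))) , refl
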